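{- Let $m\in\mathbb{N}$. For any sets $D$ and $Z$ such that $Z^{(m)}$ is not $(x \mapsto 2^x)$-DNC over $D^{(m)}$, there exists a set $G$ such that $G^{(m)}$ is DNC over $D^{(m)}$ and $(Z \oplus G)^{(m)}$ is not $(x \mapsto 2^x)$-DNC over $D^{(m)}$.
   Context: $X^{(m)}$ is the $m$-th Turing jump; $\oplus$ is the Turing join. A function $g:\mathbb{N}\to\mathbb{N}$ is DNC over $D$ if for every $e$, $\Phi^D_e(e)\downarrow$ implies $g(e)\ne\Phi^D_e(e)$; a set is DNC over $D$ if it computes such a function. For $h:\mathbb{N}\to\mathbb{N}$, $g$ is $h$-DNC over $D$ if $g$ is DNC over $D$ and $g(x)<h(x)$ for all $x$; a set is $h$-DNC over $D$ if it computes a function that is $h$-DNC over $D$. -}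

module Defs where

open import Data.Nat using (ℕ; zero; suc; _+_; _*_; _^_; _<_)
open import Data.Fin using (Fin; toℕ)
open import Data.Vec using (Vec; []; _∷_; lookup)
open import Data.Product using (Σ; ∃; _×_; _,_)
open import Data.Sum using (_⊎_)
open import Relation.Nullary using (¬_)
open import Relation.Binary.PropositionalEquality using (_≡_)

SetN : Set₁
SetN = ℕ → Set

data Code : ℕ → Set where
  zer  : ∀ {n} → Code n
  succ : Code 1
  proj : ∀ {n} → Fin n → Code n
  orc  : Code 1
  comp : ∀ {m n} → Code m → Vec (Code n) m → Code n
  prec : ∀ {n} → Code n → Code (suc (suc n)) → Code (suc n)
  mu   : ∀ {n} → Code (suc n) → Code n

mutual
  data Eval (X : SetN) : ∀ {n} → Code n → Vec ℕ n → ℕ → Set where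
    ev-zer  : ∀ {n} {xs : Vec ℕ n} → Eval X zer xs 0
    ev-succ : ∀ {x} → Eval X succ (x ∷ []) (suc x)
    ev-proj : ∀ {n} (i : Fin n) {xs : Vec ℕ n} → Eval X (proj i) xs (lookup xs i)
    ev-orc1 : ∀ {x} → X x → Eval X orc (x ∷ []) 1
    ev-orc0 : ∀ {x} → ¬ X x → Eval X orc (x ∷ []) 0
    ev-comp : ∀ {m n} {f : Code m} {gs : Vec (Code n) m} {xs : Vec ℕ n}
                {ys : Vec ℕ m} {z} →
              EvalV X xs gs ys → Eval X f ys z → Eval X (comp f gs) xs z
    ev-prec0 : ∀ {n} {f : Code n} {g : Code (suc (suc n))} {xs : Vec ℕ n} {z} →
               Eval X f xs z → Eval X (prec f g) (0 ∷ xs) z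
    ev-precS : ∀ {n} {f : Code n} {g : Code (suc (suc n))} {xs : Vec ℕ n} {k w z} →
               Eval X (prec f g) (k ∷ xs) w → Eval X g (k ∷ w ∷ xs) z →
               Eval X (prec f g) (suc k ∷ xs) z
    ev-mu : ∀ {n} {f : Code (suc n)} {xs : Vec ℕ n} {k} →
            Eval X f (k ∷ xs) 0 →
            (∀ j → j < k → Σ ℕ λ v → Eval X f (j ∷ xs) (suc v)) →
            Eval X (mu f) xs k

  data EvalV (X : SetN) {n : ℕ} (xs : Vec ℕ n) : ∀ {m} → Vec (Code n) m → Vec ℕ m → Set where
    evv-[] : EvalV X xs [] []
    evv-∷  : ∀ {m} {g : Code n} {gs : Vec (Code n) m} {y ys} →
             Eval X g xs y → EvalV X xs gs ys → EvalV X xs (g ∷ gs) (y ∷ ys)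

-- Goedel numbering of codes (injective pairing ⟪a,b⟫ = 2^a (2b+1)).
-- Numbers not of the required shape code no program (everywhere divergent).

⟪_,_⟫ : ℕ → ℕ → ℕ
⟪ a , b ⟫ = 2 ^ a * (2 * b + 1)

mutual
  data Decode : (n : ℕ) → ℕ → Code n → Set where
    dc-zer  : ∀ {n} → Decode n ⟪ 0 , 0 ⟫ zer
    dc-succ : Decode 1 ⟪ 1 , 0 ⟫ succ
    dc-proj : ∀ {n} (i : Fin n) → Decode n ⟪ 2 , toℕ i ⟫ (proj i)
    dc-orc  : Decode 1 ⟪ 3 , 0 ⟫ orc
    dc-comp : ∀ {m n a b} {f : Code m} {gs : Vec (Code n) m} →
              Decode m a f → DecodeV n m b gs →
              Decode n ⟪ 4 , ⟪ m , ⟪ a , b ⟫ ⟫ ⟫ (comp f gs)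
    dc-prec : ∀ {n a b} {f : Code n} {g : Code (suc (suc n))} →
              Decode n a f → Decode (suc (suc n)) b g →
              Decode (suc n) ⟪ 5 , ⟪ a , b ⟫ ⟫ (prec f g)
    dc-mu   : ∀ {n a} {f : Code (suc n)} →
              Decode (suc n) a f → Decode n ⟪ 6 , a ⟫ (mu f)

  data DecodeV (n : ℕ) : (m : ℕ) → ℕ → Vec (Code n) m → Set where
    dcv-[] : DecodeV n 0 0 []
    dcv-∷  : ∀ {m a b} {g : Code n} {gs : Vec (Code n) m} →
             Decode n a g → DecodeV n m b gs →
             DecodeV n (suc m) ⟪ a , b ⟫ (g ∷ gs)

Φ : SetN → ℕ → ℕ → ℕ → Set
Φ X e x y = Σ (Code 1) λ c → Decode 1 e c × Eval X c (x ∷ []) y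


Halts : SetN → ℕ → ℕ → Set
Halts X e x = ∃ λ y → Φ X e x y

jump : SetN → SetN
jump X e = Halts X e e

jumpⁿ : ℕ → SetN → SetN
jumpⁿ zero    X = X
jumpⁿ (suc m) X = jump (jumpⁿ m X)

_⊕_ : SetN → SetN → SetN
(X ⊕ Y) k = (Σ ℕ λ n → k ≡ 2 * n × X n) ⊎ (Σ ℕ λ n → k ≡ suc (2 * n) × Y n)

Computes : SetN → (ℕ → ℕ) → Set
Computes X g = ∃ λ e → ∀ x → Φ X e x (g x)

IsDNC : SetN → (ℕ → ℕ) → Set
IsDNC D g = ∀ e y → Φ D e e y → ¬ (g e ≡ y)

IsHDNC : (ℕ → ℕ) → SetN → (ℕ → ℕ) → Set
IsHDNC h D g = IsDNC D g × (∀ x → g x < h x)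

DNC : SetN → SetN → Set
DNC D X = Σ (ℕ → ℕ) λ g → Computes X g × IsDNC D g

HDNC : (ℕ → ℕ) → SetN → SetN → Set
HDNC h D X = Σ (ℕ → ℕ) λ g → Computes X g × IsHDNC h D g

pow2 : ℕ → ℕ
pow2 x = 2 ^ x

{-# OPTIONS --safe #-}
module Submission where

open import Defs
open import Data.Nat
open import Data.Nat.Properties
open import Data.Fin using (Fin; zero; suc; toℕ; #_; fromℕ<)
open import Data.Fin.Properties using (toℕ-injective; toℕ-fromℕ<; toℕ<n)
open import Data.Vec using (Vec; []; _∷_; lookup)
open import Data.List as List using (List; []; _∷_; _++_; foldl; length)
open import Data.List.Properties using (foldl-++)
open import Data.List.Relation.Unary.All as All using (All; []; _∷_)
open import Data.List.Relation.Unary.All.Properties using (++⁻)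
open import Data.List.Relation.Unary.Any using (here; there)
import Data.List.Relation.Unary.Any as Any
open import Data.List.Relation.Unary.Any.Properties using (lookup-index)
open import Data.List.Membership.Propositional using (_∈_)
open import Data.Product using (Σ; ∃; _×_; _,_; proj₁; proj₂)
open import Data.Sum using (_⊎_; inj₁; inj₂)
open import Data.Unit using (⊤)
open import Data.Empty using (⊥; ⊥-elim)
open import Relation.Nullary using (¬_; yes; no)
open import Relation.Binary.Definitions using (tri<; tri≈; tri>)
open import Relation.Binary.PropositionalEquality
  using (_≡_; refl; sym; trans; cong; cong₂; subst; subst₂)
open import Level using (0ℓ)
open import Axiom.ExcludedMiddle using (ExcludedMiddle)

-- Iterating Friedberg jump inversion m times turns any set A into a G ≥T Z with A ≤T G⁽ᵐ⁾ ≤T Z⁽ᵐ⁾ ⊕ A,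
-- so it suffices to find an A that is DNC over D⁽ᵐ⁾ such that Z⁽ᵐ⁾ ⊕ A is not 2ˣ-DNC over D⁽ᵐ⁾.
-- Write D and Z for these jumps.  A is the graph of a function obtained by bushy tree forcing.  A condition is a
-- string σ and a set B of strings to be avoided that is k-small above σ: no finite k-bushy tree above
-- σ has all its leaves in B.  For the e-th functional, either for some x the strings forcing a value
-- below 2ˣ at x stay small together with B, and B absorbs them; or for every x some i < 2ˣ is
-- forced on a k-big set.  In that case Z computes such an i from x, and since Z is not 2ˣ-DNC over D,
-- some i equals Φ_x(x); as B is k-small, σ extends to a string that forces this value and has B small above it.
-- Both constructions ask whether a finite string with a halting computation exists.  All these questions
-- are derivability in one finite system of Horn clauses, whose derivations are checked by a primitive
-- recursive stack machine that serves as the universal machine.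

-- Codes of programs

-- Forcing directly against the m-th jump of `Z ⊕ G` would need a forcing relation for iterated
-- jumps; inversion leaves only the case m = 0, for arbitrary D and Z. The forcing rests on an
-- asymmetry. The set B of a condition is never searched and may be arbitrary. Only sets of strings
-- that force a given value are searched, and their bigness above a string is a Σ₁ question relative
-- to Z; hence Z can compute the choice of i. The bound 2ˣ makes the choice possible. If B together
-- with the strings forcing some value below 2ˣ is big for k(2ˣ + 1) + 1 while B is k-small, then a
-- single value is forced on a k-big set. The size k may grow at each stage, since a node has
-- infinitely many children. Initially B consists of the strings having the letter Φ_n(n) at some
-- position n. At most one child of a node acquires such a letter at its end, so k = 2 suffices.
-- Excluded middle provides characteristic functions of predicates and the non-effective choice of
-- conditions.

⟪⟫-suc : ∀ a b → ⟪ suc a , b ⟫ ≡ 2 * ⟪ a , b ⟫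
⟪⟫-suc a b = *-assoc 2 (2 ^ a) (2 * b + 1)

⟪⟫-zero : ∀ b → ⟪ 0 , b ⟫ ≡ 2 * b + 1
⟪⟫-zero b = *-identityˡ (2 * b + 1)

⟪⟫-injective : ∀ a b a' b' → ⟪ a , b ⟫ ≡ ⟪ a' , b' ⟫ → a ≡ a' × b ≡ b'
⟪⟫-injective zero b zero b' eq = refl , *-cancelˡ-≡ b b' 2
  (+-cancelʳ-≡ 1 (2 * b) (2 * b') (trans (sym (⟪⟫-zero b)) (trans eq (⟪⟫-zero b'))))
⟪⟫-injective zero b (suc a') b' eq = ⊥-elim (even≢odd ⟪ a' , b' ⟫ b
  (trans (sym (⟪⟫-suc a' b')) (trans (sym eq) (trans (⟪⟫-zero b) (+-comm (2 * b) 1)))))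
⟪⟫-injective (suc a) b zero b' eq = ⊥-elim (even≢odd ⟪ a , b ⟫ b'
  (trans (sym (⟪⟫-suc a b)) (trans eq (trans (⟪⟫-zero b') (+-comm (2 * b') 1)))))
⟪⟫-injective (suc a) b (suc a') b' eq
  with ⟪⟫-injective a b a' b' (*-cancelˡ-≡ ⟪ a , b ⟫ ⟪ a' , b' ⟫ 2
         (trans (sym (⟪⟫-suc a b)) (trans eq (⟪⟫-suc a' b'))))
... | p , q = cong suc p , q

-- Opaque, so that codes are compared structurally, without unfolding powers of 2.
opaque
  pr : ℕ → ℕ → ℕ
  pr a b = ⟪ a , b ⟫

  pr-def : ∀ a b → pr a b ≡ ⟪ a , b ⟫
  pr-def a b = refl

pr-injective : ∀ {a b a' b'} → pr a b ≡ pr a' b' → a ≡ a' × b ≡ b'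
pr-injective {a} {b} {a'} {b'} eq =
  ⟪⟫-injective a b a' b' (trans (sym (pr-def a b)) (trans eq (pr-def a' b')))

0≢pr : ∀ {a b} → ¬ 0 ≡ pr a b
0≢pr {a} {b} eq = <-irrefl (trans eq (pr-def a b))
  (*-mono-≤ (m^n>0 2 a) (≤-trans (s≤s z≤n) (m≤n+m 1 (2 * b))))

mutual
  tag : ∀ {n} → Code n → ℕ
  tag zer         = 0
  tag succ        = 1
  tag (proj i)    = 2
  tag orc         = 3
  tag (comp f gs) = 4
  tag (prec f g)  = 5
  tag (mu f)      = 6

  body : ∀ {n} → Code n → ℕ
  body zer                = 0
  body succ               = 0
  body (proj i)           = toℕ i
  body orc                = 0
  body (comp {m} f gs)    = pr m (pr (gn f) (gnV gs))
  body (prec f g)         = pr (gn f) (gn g)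
  body (mu f)             = gn f

  gn : ∀ {n} → Code n → ℕ
  gn c = pr (tag c) (body c)

  gnV : ∀ {n m} → Vec (Code n) m → ℕ
  gnV []       = 0
  gnV (g ∷ gs) = pr (gn g) (gnV gs)

mutual
  -- Tags are numerals, so distinct constructors are refuted by an absurd pattern; an equation
  -- between the opaque numbers `gn c` and `gn d` would not reduce that far.
  code-unique : ∀ {n} (c d : Code n) → tag c ≡ tag d → body c ≡ body d → c ≡ d
  code-unique zer zer _ _ = refl
  code-unique succ succ _ _ = refl
  code-unique (proj i) (proj j) _ eq = cong proj (toℕ-injective eq)
  code-unique orc orc _ _ = refl
  code-unique (comp f gs) (comp f' gs') _ eq with pr-injective eq
  ... | refl , eq' with pr-injective eq'
  ... | p , q = cong₂ comp (gn-injective f f' p) (gnV-injective gs gs' q)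
  code-unique (prec f g) (prec f' g') _ eq with pr-injective eq
  ... | p , q = cong₂ prec (gn-injective f f' p) (gn-injective g g' q)
  code-unique (mu f) (mu f') _ eq = cong mu (gn-injective f f' eq)
  code-unique zer succ () _
  code-unique zer (proj _) () _
  code-unique zer orc () _
  code-unique zer (comp _ _) () _
  code-unique zer (prec _ _) () _
  code-unique zer (mu _) () _
  code-unique succ zer () _
  code-unique succ (proj _) () _
  code-unique succ orc () _
  code-unique succ (comp _ _) () _
  code-unique succ (prec _ _) () _
  code-unique succ (mu _) () _
  code-unique (proj _) zer () _
  code-unique (proj _) succ () _
  code-unique (proj _) orc () _
  code-unique (proj _) (comp _ _) () _
  code-unique (proj _) (prec _ _) () _
  code-unique (proj _) (mu _) () _
  code-unique orc zer () _
  code-unique orc succ () _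
  code-unique orc (proj _) () _
  code-unique orc (comp _ _) () _
  code-unique orc (prec _ _) () _
  code-unique orc (mu _) () _
  code-unique (comp _ _) zer () _
  code-unique (comp _ _) succ () _
  code-unique (comp _ _) (proj _) () _
  code-unique (comp _ _) orc () _
  code-unique (comp _ _) (prec _ _) () _
  code-unique (comp _ _) (mu _) () _
  code-unique (prec _ _) zer () _
  code-unique (prec _ _) succ () _
  code-unique (prec _ _) (proj _) () _
  code-unique (prec _ _) orc () _
  code-unique (prec _ _) (comp _ _) () _
  code-unique (prec _ _) (mu _) () _
  code-unique (mu _) zer () _
  code-unique (mu _) succ () _
  code-unique (mu _) (proj _) () _
  code-unique (mu _) orc () _
  code-unique (mu _) (comp _ _) () _
  code-unique (mu _) (prec _ _) () _

  gn-injective : ∀ {n} (c d : Code n) → gn c ≡ gn d → c ≡ d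
  gn-injective c d eq with pr-injective eq
  ... | p , q = code-unique c d p q

  gnV-injective : ∀ {n m} (cs ds : Vec (Code n) m) → gnV cs ≡ gnV ds → cs ≡ ds
  gnV-injective []       []       _  = refl
  gnV-injective (c ∷ cs) (d ∷ ds) eq with pr-injective eq
  ... | p , q = cong₂ _∷_ (gn-injective c d p) (gnV-injective cs ds q)

mutual
  decode→gn : ∀ {n e} {c : Code n} → Decode n e c → e ≡ gn c
  decode→gn dc-zer      = sym (pr-def 0 0)
  decode→gn dc-succ     = sym (pr-def 1 0)
  decode→gn (dc-proj i) = sym (pr-def 2 (toℕ i))
  decode→gn dc-orc      = sym (pr-def 3 0)
  decode→gn (dc-comp {m} d ds) = trans
    (cong (λ z → ⟪ 4 , ⟪ m , z ⟫ ⟫)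
      (trans (cong₂ ⟪_,_⟫ (decode→gn d) (decodeV→gnV ds)) (sym (pr-def _ _))))
    (trans (cong ⟪ 4 ,_⟫ (sym (pr-def _ _))) (sym (pr-def _ _)))
  decode→gn (dc-prec d d') = trans
    (cong ⟪ 5 ,_⟫ (trans (cong₂ ⟪_,_⟫ (decode→gn d) (decode→gn d')) (sym (pr-def _ _))))
    (sym (pr-def _ _))
  decode→gn (dc-mu d) = trans (cong ⟪ 6 ,_⟫ (decode→gn d)) (sym (pr-def _ _))

  decodeV→gnV : ∀ {n m e} {cs : Vec (Code n) m} → DecodeV n m e cs → e ≡ gnV cs
  decodeV→gnV dcv-[]       = refl
  decodeV→gnV (dcv-∷ d ds) =
    trans (cong₂ ⟪_,_⟫ (decode→gn d) (decodeV→gnV ds)) (sym (pr-def _ _))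

opaque
  unfolding pr
  mutual
    decode-gn : ∀ {n} (c : Code n) → Decode n (gn c) c
    decode-gn zer         = dc-zer
    decode-gn succ        = dc-succ
    decode-gn (proj i)    = dc-proj i
    decode-gn orc         = dc-orc
    decode-gn (comp f gs) = dc-comp (decode-gn f) (decodeV-gnV gs)
    decode-gn (prec f g)  = dc-prec (decode-gn f) (decode-gn g)
    decode-gn (mu f)      = dc-mu (decode-gn f)

    decodeV-gnV : ∀ {n m} (cs : Vec (Code n) m) → DecodeV n m (gnV cs) cs
    decodeV-gnV []       = dcv-[]
    decodeV-gnV (c ∷ cs) = dcv-∷ (decode-gn c) (decodeV-gnV cs)

mutual
  Eval-functional : ∀ {X n} {c : Code n} {xs y z} → Eval X c xs y → Eval X c xs z → y ≡ z
  Eval-functional ev-zer ev-zer = refl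
  Eval-functional ev-succ ev-succ = refl
  Eval-functional (ev-proj i) (ev-proj .i) = refl
  Eval-functional (ev-orc1 p) (ev-orc1 q) = refl
  Eval-functional (ev-orc1 p) (ev-orc0 q) = ⊥-elim (q p)
  Eval-functional (ev-orc0 p) (ev-orc1 q) = ⊥-elim (p q)
  Eval-functional (ev-orc0 p) (ev-orc0 q) = refl
  Eval-functional (ev-comp ps p) (ev-comp qs q) with EvalV-functional ps qs
  ... | refl = Eval-functional p q
  Eval-functional (ev-prec0 p) (ev-prec0 q) = Eval-functional p q
  Eval-functional (ev-precS p p') (ev-precS q q') with Eval-functional p q
  ... | refl = Eval-functional p' q'
  Eval-functional {y = k} {z = l} (ev-mu p ps) (ev-mu q qs) with <-cmp k l
  ... | tri< k<l _ _ = ⊥-elim (0≢1+n (Eval-functional p (proj₂ (qs k k<l))))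
  ... | tri≈ _ eq _ = eq
  ... | tri> _ _ l<k = ⊥-elim (0≢1+n (sym (Eval-functional (proj₂ (ps l l<k)) q)))

  EvalV-functional : ∀ {X n m} {cs : Vec (Code n) m} {xs ys zs} →
                     EvalV X xs cs ys → EvalV X xs cs zs → ys ≡ zs
  EvalV-functional evv-[] evv-[] = refl
  EvalV-functional (evv-∷ p ps) (evv-∷ q qs) =
    cong₂ _∷_ (Eval-functional p q) (EvalV-functional ps qs)

Φ→Eval : ∀ {X e y x} → Φ X e x y → Σ (Code 1) λ c → gn c ≡ e × Eval X c (x ∷ []) y
Φ→Eval (c , d , ev) = c , sym (decode→gn d) , ev

Eval→Φ : ∀ {X y x} (c : Code 1) → Eval X c (x ∷ []) y → Φ X (gn c) x y
Eval→Φ c ev = c , decode-gn c , ev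

Φ-functional : ∀ {X e x y z} → Φ X e x y → Φ X e x z → y ≡ z
Φ-functional (c , d , ev) (c' , d' , ev')
  with gn-injective c c' (trans (sym (decode→gn d)) (decode→gn d'))
... | refl = Eval-functional ev ev'

-- Total functions computable relative to a set

Fn : SetN → (n : ℕ) → (Vec ℕ n → ℕ) → Set
Fn X n f = Σ (Code n) λ c → ∀ xs → Eval X c xs (f xs)

un1 : (ℕ → ℕ) → Vec ℕ 1 → ℕ
un1 f (x ∷ []) = f x

un2 : (ℕ → ℕ → ℕ) → Vec ℕ 2 → ℕ
un2 f (x ∷ y ∷ []) = f x y

Fn₁ : SetN → (ℕ → ℕ) → Set
Fn₁ X f = Fn X 1 (un1 f)

Fn₂ : SetN → (ℕ → ℕ → ℕ) → Set
Fn₂ X f = Fn X 2 (un2 f)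

Fn-cong : ∀ {X n f g} → (∀ xs → f xs ≡ g xs) → Fn X n f → Fn X n g
Fn-cong {X} eq (c , ok) = c , λ xs → subst (Eval X c xs) (eq xs) (ok xs)

Fn₁-cong : ∀ {X f g} → (∀ x → f (x ∷ []) ≡ g x) → Fn X 1 f → Fn₁ X g
Fn₁-cong eq = Fn-cong λ { (x ∷ []) → eq x }

Fn₂-cong : ∀ {X f g} → (∀ x y → f (x ∷ y ∷ []) ≡ g x y) → Fn X 2 f → Fn₂ X g
Fn₂-cong eq = Fn-cong λ { (x ∷ y ∷ []) → eq x y }

-- A function symbol carries the function together with a code computing it. Thus `⟦_⟧` reduces to
-- the intended expression, and most correctness equations hold by `refl`.
data Tm (X : SetN) (V : ℕ) : Set where
  var : Fin V → Tm X V
  app : ∀ {k} (f : Vec ℕ k → ℕ) → Fn X k f → Vec (Tm X V) k → Tm X V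

mutual
  ⟦_⟧ : ∀ {X V} → Tm X V → Vec ℕ V → ℕ
  ⟦ var i ⟧      v = lookup v i
  ⟦ app f _ ts ⟧ v = f (⟦ ts ⟧* v)

  ⟦_⟧* : ∀ {X V k} → Vec (Tm X V) k → Vec ℕ V → Vec ℕ k
  ⟦ [] ⟧*     v = []
  ⟦ t ∷ ts ⟧* v = ⟦ t ⟧ v ∷ ⟦ ts ⟧* v

mutual
  compile : ∀ {X V} → Tm X V → Code V
  compile (var i)            = proj i
  compile (app f (c , _) ts) = comp c (compile* ts)

  compile* : ∀ {X V k} → Vec (Tm X V) k → Vec (Code V) k
  compile* []       = []
  compile* (t ∷ ts) = compile t ∷ compile* ts

mutual
  compile-correct : ∀ {X V} (t : Tm X V) v → Eval X (compile t) v (⟦ t ⟧ v)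
  compile-correct (var i)             v = ev-proj i
  compile-correct (app f (c , ok) ts) v = ev-comp (compile*-correct ts v) (ok (⟦ ts ⟧* v))

  compile*-correct : ∀ {X V k} (ts : Vec (Tm X V) k) v → EvalV X v (compile* ts) (⟦ ts ⟧* v)
  compile*-correct []       v = evv-[]
  compile*-correct (t ∷ ts) v = evv-∷ (compile-correct t v) (compile*-correct ts v)

fn : ∀ {X V} (t : Tm X V) → Fn X V ⟦ t ⟧
fn t = compile t , compile-correct t

ap1 : ∀ {X V f} → Fn₁ X f → Tm X V → Tm X V
ap1 {f = f} F t = app (un1 f) F (t ∷ [])

ap2 : ∀ {X V f} → Fn₂ X f → Tm X V → Tm X V → Tm X V
ap2 {f = f} F s t = app (un2 f) F (s ∷ t ∷ [])

sucFn : ∀ {X} → Fn₁ X suc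
sucFn = succ , λ { (x ∷ []) → ev-succ }

constCode : ∀ {n} → ℕ → Code n
constCode zero    = zer
constCode (suc k) = comp succ (constCode k ∷ [])

constCode-correct : ∀ {X n} k (xs : Vec ℕ n) → Eval X (constCode k) xs k
constCode-correct zero    xs = ev-zer
constCode-correct (suc k) xs = ev-comp (evv-∷ (constCode-correct k xs) evv-[]) ev-succ

con : ∀ {X V} → ℕ → Tm X V
con k = app {k = 0} (λ _ → k) (constCode k , constCode-correct k) []

v0 : ∀ {X V} → Tm X (suc V)
v0 = var zero

v1 : ∀ {X V} → Tm X (suc (suc V))
v1 = var (suc zero)

v2 : ∀ {X V} → Tm X (suc (suc (suc V)))
v2 = var (suc (suc zero))

v3 : ∀ {X V} → Tm X (suc (suc (suc (suc V))))
v3 = var (suc (suc (suc zero)))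

natrec : ∀ {n} → (Vec ℕ n → ℕ) → (Vec ℕ (suc (suc n)) → ℕ) → Vec ℕ (suc n) → ℕ
natrec f g (zero  ∷ xs) = f xs
natrec f g (suc k ∷ xs) = g (k ∷ natrec f g (k ∷ xs) ∷ xs)

precFn : ∀ {X n f g} → Fn X n f → Fn X (suc (suc n)) g → Fn X (suc n) (natrec f g)
precFn {X} {n} {f} {g} (c , ok) (d , ok') = prec c d , correct
  where
  correct : ∀ xs → Eval X (prec c d) xs (natrec f g xs)
  correct (zero  ∷ xs) = ev-prec0 (ok xs)
  correct (suc k ∷ xs) = ev-precS (correct (k ∷ xs)) (ok' _)

predFn : ∀ {X} → Fn₁ X pred
predFn = Fn-cong (λ { (zero ∷ []) → refl ; (suc x ∷ []) → refl }) (precFn (fn (con 0)) (fn v0))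

addFn : ∀ {X} → Fn₂ X _+_
addFn = Fn₂-cong eq (precFn (fn v0) (fn (ap1 sucFn v1)))
  where
  eq : ∀ x y → natrec _ _ (x ∷ y ∷ []) ≡ x + y
  eq zero    y = refl
  eq (suc x) y = cong suc (eq x y)

mulFn : ∀ {X} → Fn₂ X _*_
mulFn = Fn₂-cong eq (precFn (fn (con 0)) (fn (ap2 addFn v2 v1)))
  where
  eq : ∀ x y → natrec _ _ (x ∷ y ∷ []) ≡ x * y
  eq zero    y = refl
  eq (suc x) y = cong (y +_) (eq x y)

pow2Fn : ∀ {X} → Fn₁ X pow2
pow2Fn = Fn₁-cong eq (precFn (fn (con 1)) (fn (ap2 mulFn (con 2) v1)))
  where
  eq : ∀ x → natrec _ _ (x ∷ []) ≡ 2 ^ x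
  eq zero    = refl
  eq (suc x) = cong (2 *_) (eq x)

monusFn : ∀ {X} → Fn₂ X _∸_
-- Primitive recursion runs on the first argument, whereas `_∸_` iterates `pred` along the second.
monusFn = Fn₂-cong (λ _ _ → refl) (fn (app _ reversed (v1 ∷ v0 ∷ [])))
  where
  eq : ∀ y x → natrec _ _ (y ∷ x ∷ []) ≡ x ∸ y
  eq zero    x = refl
  eq (suc y) x = trans (cong pred (eq y x)) (pred[m∸n]≡m∸[1+n] x y)

  reversed : ∀ {X} → Fn X 2 (un2 λ y x → x ∸ y)
  reversed = Fn₂-cong eq (precFn (fn v0) (fn (ap1 predFn v1)))

dist : ℕ → ℕ → ℕ
dist x y = (x ∸ y) + (y ∸ x)

dist-refl : ∀ x → dist x x ≡ 0
dist-refl x = cong₂ _+_ (n∸n≡0 x) (n∸n≡0 x)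

dist≡0 : ∀ x y → dist x y ≡ 0 → x ≡ y
dist≡0 x y eq = ≤-antisym (m∸n≡0⇒m≤n (m+n≡0⇒m≡0 (x ∸ y) eq)) (m∸n≡0⇒m≤n (m+n≡0⇒n≡0 (x ∸ y) eq))

distFn : ∀ {X} → Fn₂ X dist
distFn = Fn₂-cong (λ _ _ → refl) (fn (ap2 addFn (ap2 monusFn v0 v1) (ap2 monusFn v1 v0)))

-- Case distinction, parity, unpairing and minimisation

ifz : ℕ → ℕ → ℕ → ℕ
ifz zero    a b = a
ifz (suc _) a b = b

un3 : (ℕ → ℕ → ℕ → ℕ) → Vec ℕ 3 → ℕ
un3 f (x ∷ y ∷ z ∷ []) = f x y z

ifzFn : ∀ {X} → Fn X 3 (un3 ifz)
ifzFn = Fn-cong (λ { (zero ∷ a ∷ b ∷ []) → refl ; (suc _ ∷ a ∷ b ∷ []) → refl })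
                (precFn (fn v0) (fn v3))

if0 : ∀ {X V} → Tm X V → Tm X V → Tm X V → Tm X V
if0 c a b = app (un3 ifz) ifzFn (c ∷ a ∷ b ∷ [])

odd : ℕ → ℕ
odd zero    = 0
odd (suc n) = 1 ∸ odd n

half : ℕ → ℕ
half zero    = 0
half (suc n) = half n + odd n

oddFn : ∀ {X} → Fn₁ X odd
oddFn = Fn₁-cong eq (precFn (fn (con 0)) (fn (ap2 monusFn (con 1) v1)))
  where
  eq : ∀ x → natrec _ _ (x ∷ []) ≡ odd x
  eq zero    = refl
  eq (suc x) = cong (1 ∸_) (eq x)

halfFn : ∀ {X} → Fn₁ X half
halfFn = Fn₁-cong eq (precFn (fn (con 0)) (fn (ap2 addFn v1 (ap1 oddFn v0))))
  where
  eq : ∀ x → natrec _ _ (x ∷ []) ≡ half x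
  eq zero    = refl
  eq (suc x) = cong (_+ odd x) (eq x)

odd-double : ∀ x → odd (2 * x) ≡ 0
odd-double zero    = refl
odd-double (suc x) rewrite +-suc x (x + 0) | odd-double x = refl

half-even : ∀ x → half (2 * x) ≡ x
half-even zero    = refl
half-even (suc x) rewrite +-suc x (x + 0) | odd-double x | half-even x | +-identityʳ x = +-comm x 1

half-odd : ∀ x → half (suc (2 * x)) ≡ x
half-odd x rewrite odd-double x | half-even x = +-identityʳ x

even-or-odd : ∀ x → (Σ ℕ λ n → x ≡ 2 * n) ⊎ (Σ ℕ λ n → x ≡ suc (2 * n))
even-or-odd zero = inj₁ (0 , refl)
even-or-odd (suc x) with even-or-odd x
... | inj₁ (n , eq) = inj₂ (n , cong suc eq)
... | inj₂ (n , eq) = inj₁ (suc n , trans (cong suc eq) (sym (*-suc 2 n)))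

prFn : ∀ {X} → Fn₂ X pr
prFn = Fn₂-cong (λ a b → sym (pr-def a b))
  (fn (ap2 mulFn (ap1 pow2Fn v0) (ap2 addFn (ap2 mulFn (con 2) v1) (con 1))))

-- Unpairing of 2^a (2b + 1): each round halves an even number and keeps an odd one. In `fst` and
-- `snd`, `z` rounds suffice for `z` itself because of `a<⟪a,b⟫`.
strip : ℕ → ℕ → ℕ
strip zero    z = z
strip (suc k) z = ifz (odd (strip k z)) (half (strip k z)) (strip k z)

-- The number of halvings performed by strip k z.
valuation : ℕ → ℕ → ℕ
valuation zero    z = 0
valuation (suc k) z = valuation k z + (1 ∸ odd (strip k z))

fst : ℕ → ℕ
fst z = valuation z z

snd : ℕ → ℕ
snd z = half (strip z z)

strip-⟪⟫ : ∀ k a b → strip k ⟪ a , b ⟫ ≡ ⟪ a ∸ k , b ⟫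
strip-⟪⟫ zero    a b = refl
strip-⟪⟫ (suc k) a b rewrite strip-⟪⟫ k a b | sym (pred[m∸n]≡m∸[1+n] a k) with a ∸ k
... | zero  rewrite ⟪⟫-zero b | +-comm (2 * b) 1 | odd-double b = refl
... | suc n rewrite ⟪⟫-suc n b | odd-double ⟪ n , b ⟫ = half-even ⟪ n , b ⟫

valuation-⟪⟫ : ∀ k a b → valuation k ⟪ a , b ⟫ ≡ k ⊓ a
valuation-⟪⟫ zero    a b = refl
valuation-⟪⟫ (suc k) a b rewrite strip-⟪⟫ k a b | valuation-⟪⟫ k a b with a ∸ k in eq
... | zero  rewrite ⟪⟫-zero b | +-comm (2 * b) 1 | odd-double b =
  trans (+-identityʳ (k ⊓ a)) (trans (m≥n⇒m⊓n≡n a≤k) (sym (m≥n⇒m⊓n≡n (m≤n⇒m≤1+n a≤k))))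
  where
  a≤k : a ≤ k
  a≤k = m∸n≡0⇒m≤n eq
... | suc n rewrite ⟪⟫-suc n b | odd-double ⟪ n , b ⟫ =
  trans (cong (_+ 1) (m≤n⇒m⊓n≡m (<⇒≤ k<a))) (trans (+-comm k 1) (sym (m≤n⇒m⊓n≡m k<a)))
  where
  k<a : k < a
  k<a = m∸n≢0⇒n<m λ e → 0≢1+n (trans (sym e) eq)

a<⟪a,b⟫ : ∀ a b → a < ⟪ a , b ⟫
a<⟪a,b⟫ a b = ≤-trans (n<2^n a) (m≤m*n (2 ^ a) (2 * b + 1) ⦃ ≢-nonZero (λ e → 0≢1+n (sym (trans (+-comm 1 (2 * b)) e))) ⦄)
  where
  n<2^n : ∀ n → n < 2 ^ n
  n<2^n zero    = s≤s z≤n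
  n<2^n (suc n) = ≤-trans (+-mono-≤ (≤-trans (s≤s z≤n) (n<2^n n)) (n<2^n n))
                    (≤-reflexive (cong (2 ^ n +_) (sym (+-identityʳ (2 ^ n)))))

fst-pr : ∀ a b → fst (pr a b) ≡ a
fst-pr a b rewrite pr-def a b =
  trans (valuation-⟪⟫ ⟪ a , b ⟫ a b) (m≥n⇒m⊓n≡n (<⇒≤ (a<⟪a,b⟫ a b)))

snd-pr : ∀ a b → snd (pr a b) ≡ b
snd-pr a b rewrite pr-def a b | strip-⟪⟫ ⟪ a , b ⟫ a b
  | m≤n⇒m∸n≡0 (<⇒≤ (a<⟪a,b⟫ a b)) | ⟪⟫-zero b | +-comm (2 * b) 1 = half-odd b

stripFn : ∀ {X} → Fn₂ X strip
stripFn = Fn₂-cong eq (precFn (fn v0) (fn (if0 (ap1 oddFn v1) (ap1 halfFn v1) v1)))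
  where
  eq : ∀ k z → natrec _ _ (k ∷ z ∷ []) ≡ strip k z
  eq zero    z = refl
  eq (suc k) z = cong (λ s → ifz (odd s) (half s) s) (eq k z)

valuationFn : ∀ {X} → Fn₂ X valuation
valuationFn = Fn₂-cong eq
  (precFn (fn (con 0)) (fn (ap2 addFn v1 (ap2 monusFn (con 1) (ap1 oddFn (ap2 stripFn v0 v2))))))
  where
  eq : ∀ k z → natrec _ _ (k ∷ z ∷ []) ≡ valuation k z
  eq zero    z = refl
  eq (suc k) z = cong (_+ (1 ∸ odd (strip k z))) (eq k z)

fstFn : ∀ {X} → Fn₁ X fst
fstFn = Fn₁-cong (λ _ → refl) (fn (ap2 valuationFn v0 v0))

sndFn : ∀ {X} → Fn₁ X snd
sndFn = Fn₁-cong (λ _ → refl) (fn (ap1 halfFn (ap2 stripFn v0 v0)))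

-- Shaped for `ev-mu`, which wants every value below the least zero exhibited as a successor.
least : (f : ℕ → ℕ) → ∀ w → f w ≡ 0 → Σ ℕ λ k → f k ≡ 0 × (∀ j → j < k → Σ ℕ λ v → f j ≡ suc v)
least f w fw≡0 with f 0 in eq
... | zero  = 0 , eq , λ j ()
... | suc v with w
...   | zero   = ⊥-elim (0≢1+n (trans (sym fw≡0) eq))
...   | suc w' with least (λ k → f (suc k)) w' fw≡0
...     | k , fk≡0 , below = suc k , fk≡0 , λ { zero _ → v , eq ; (suc j) (s≤s j<k) → below j j<k }

muFn : ∀ {X n f} → Fn X (suc n) f → (∀ xs → ∃ λ w → f (w ∷ xs) ≡ 0) →
       Σ (Vec ℕ n → ℕ) λ g → Fn X n g × (∀ xs → f (g xs ∷ xs) ≡ 0)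
muFn {X} {n} {f} (c , ok) total = (λ xs → proj₁ (m xs)) , (mu c , correct) , λ xs → proj₁ (proj₂ (m xs))
  where
  m : ∀ xs → _
  m xs = least (λ w → f (w ∷ xs)) (proj₁ (total xs)) (proj₂ (total xs))

  correct : ∀ xs → Eval X (mu c) xs (proj₁ (m xs))
  correct xs with m xs
  ... | k , fk≡0 , below = ev-mu (subst (Eval X c (k ∷ xs)) fk≡0 (ok _))
    λ j j<k → proj₁ (below j j<k) , subst (Eval X c (j ∷ xs)) (proj₂ (below j j<k)) (ok _)

module Classical (em : ExcludedMiddle 0ℓ) where
  -- Turing reducibility

  χ : SetN → ℕ → ℕ
  χ X x with em {X x}
  ... | yes _ = 1
  ... | no  _ = 0

  χ-true : ∀ {X x} → X x → χ X x ≡ 1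
  χ-true {X} {x} p with em {X x}
  ... | yes _ = refl
  ... | no ¬p = ⊥-elim (¬p p)

  χ-false : ∀ {X x} → ¬ X x → χ X x ≡ 0
  χ-false {X} {x} ¬p with em {X x}
  ... | yes p = ⊥-elim (¬p p)
  ... | no _  = refl

  χ≡1 : ∀ {X x} → χ X x ≡ 1 → X x
  χ≡1 {X} {x} eq with em {X x}
  ... | yes p = p
  χ≡1 () | no _

  χ≡0 : ∀ {X x} → χ X x ≡ 0 → ¬ X x
  χ≡0 {X} {x} eq with em {X x}
  χ≡0 () | yes _
  ... | no ¬p = ¬p

  χ-cong : ∀ {X Y x y} → (X x → Y y) → (Y y → X x) → χ X x ≡ χ Y y
  χ-cong {X} {Y} {x} f g with em {X x}
  ... | yes p = sym (χ-true (f p))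
  ... | no ¬p = sym (χ-false λ q → ¬p (g q))

  orc-χ : ∀ X x → Eval X orc (x ∷ []) (χ X x)
  orc-χ X x with em {X x}
  ... | yes p = ev-orc1 p
  ... | no ¬p = ev-orc0 ¬p

  χFn : ∀ {X} → Fn₁ X (χ X)
  χFn {X} = orc , λ { (x ∷ []) → orc-χ X x }

  infix 4 _≤T_
  _≤T_ : SetN → SetN → Set
  A ≤T B = Fn₁ B (χ A)

  module _ (r : Code 1) where
    mutual
      replaceOrc : ∀ {n} → Code n → Code n
      replaceOrc zer         = zer
      replaceOrc succ        = succ
      replaceOrc (proj i)    = proj i
      replaceOrc orc         = r
      replaceOrc (comp f gs) = comp (replaceOrc f) (replaceOrcV gs)
      replaceOrc (prec f g)  = prec (replaceOrc f) (replaceOrc g)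
      replaceOrc (mu f)      = mu (replaceOrc f)

      replaceOrcV : ∀ {n m} → Vec (Code n) m → Vec (Code n) m
      replaceOrcV []       = []
      replaceOrcV (g ∷ gs) = replaceOrc g ∷ replaceOrcV gs

  module _ {A B : SetN} (A≤B : A ≤T B) where
    mutual
      replaceOrc-correct : ∀ {n} {c : Code n} {xs y} → Eval A c xs y → Eval B (replaceOrc (proj₁ A≤B) c) xs y
      replaceOrc-correct ev-zer         = ev-zer
      replaceOrc-correct ev-succ        = ev-succ
      replaceOrc-correct (ev-proj i)    = ev-proj i
      replaceOrc-correct (ev-orc1 p)    = subst (Eval B _ _) (χ-true p) (proj₂ A≤B _)
      replaceOrc-correct (ev-orc0 ¬p)   = subst (Eval B _ _) (χ-false ¬p) (proj₂ A≤B _)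
      replaceOrc-correct (ev-comp ps p) = ev-comp (replaceOrcV-correct ps) (replaceOrc-correct p)
      replaceOrc-correct (ev-prec0 p)   = ev-prec0 (replaceOrc-correct p)
      replaceOrc-correct (ev-precS p q) = ev-precS (replaceOrc-correct p) (replaceOrc-correct q)
      replaceOrc-correct (ev-mu p ps)   = ev-mu (replaceOrc-correct p)
        λ j j<k → proj₁ (ps j j<k) , replaceOrc-correct (proj₂ (ps j j<k))

      replaceOrcV-correct : ∀ {n m} {cs : Vec (Code n) m} {xs ys} →
                            EvalV A xs cs ys → EvalV B xs (replaceOrcV (proj₁ A≤B) cs) ys
      replaceOrcV-correct evv-[]       = evv-[]
      replaceOrcV-correct (evv-∷ p ps) = evv-∷ (replaceOrc-correct p) (replaceOrcV-correct ps)

  Fn-mono : ∀ {A B n f} → A ≤T B → Fn A n f → Fn B n f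
  Fn-mono A≤B (c , ok) = replaceOrc (proj₁ A≤B) c , λ xs → replaceOrc-correct A≤B (ok xs)

  ≤T-trans : ∀ {A B C} → A ≤T B → B ≤T C → A ≤T C
  ≤T-trans A≤B B≤C = Fn-mono B≤C A≤B

  Computes→Fn : ∀ {X g} → Computes X g → Fn₁ X g
  -- `Φ` supplies a code for each argument separately; the one found at 0 serves for all, as `gn` is
  -- injective.
  Computes→Fn {X} {g} (e , h) with h 0
  ... | c , d , _ = c , λ { (x ∷ []) → eval x (h x) }
    where
    eval : ∀ x → Φ X e x (g x) → Eval X c (x ∷ []) (g x)
    eval x (c' , d' , ev) = subst (λ c → Eval X c (x ∷ []) (g x))
      (gn-injective c' c (trans (sym (decode→gn d')) (decode→gn d))) ev

  Fn→Computes : ∀ {X g} → Fn₁ X g → Computes X g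
  Fn→Computes (c , ok) = gn c , λ x → Eval→Φ c (ok (x ∷ []))

  -- Coding of tuples; Horn clauses and the verifier of derivations

  encV : ∀ {n} → Vec ℕ n → ℕ
  encV []       = 0
  encV (x ∷ xs) = pr x (encV xs)

  encV-injective : ∀ {n} (xs ys : Vec ℕ n) → encV xs ≡ encV ys → xs ≡ ys
  encV-injective []       []       _  = refl
  encV-injective (x ∷ xs) (y ∷ ys) eq with pr-injective eq
  ... | p , q = cong₂ _∷_ p (encV-injective xs ys q)

  decV : ∀ n → ℕ → Vec ℕ n
  decV zero    z = []
  decV (suc n) z = fst z ∷ decV n (snd z)

  decV-encV : ∀ {n} (xs : Vec ℕ n) → decV n (encV xs) ≡ xs
  decV-encV []       = refl
  decV-encV (x ∷ xs) = cong₂ _∷_ (fst-pr x (encV xs))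
    (trans (cong (decV _) (snd-pr x (encV xs))) (decV-encV xs))

  encTm : ∀ {X V k} → Vec (Tm X V) k → Tm X V
  encTm []       = con 0
  encTm (t ∷ ts) = ap2 prFn t (encTm ts)

  encTm-correct : ∀ {X V k} (ts : Vec (Tm X V) k) v → ⟦ encTm ts ⟧ v ≡ encV (⟦ ts ⟧* v)
  encTm-correct []       v = refl
  encTm-correct (t ∷ ts) v = cong (pr (⟦ t ⟧ v)) (encTm-correct ts v)

  decTm : ∀ {X V} k → Tm X V → Vec (Tm X V) k
  decTm zero    t = []
  decTm (suc k) t = ap1 fstFn t ∷ decTm k (ap1 sndFn t)

  decTm-correct : ∀ {X V} k (t : Tm X V) v → ⟦ decTm k t ⟧* v ≡ decV k (⟦ t ⟧ v)
  decTm-correct zero    t v = refl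
  decTm-correct (suc k) t v = cong (fst (⟦ t ⟧ v) ∷_) (decTm-correct k (ap1 sndFn t) v)

  -- The widest goals, `evV` and `bigN`, have a predicate number and six arguments; the others are
  -- padded with zeros.
  Goal : Set
  Goal = Vec ℕ 7

  -- An instance of a clause may be used only if its side term evaluates to 0.
  record Clause (X : SetN) : Set where
    constructor clause
    field
      arity : ℕ
      concl : Vec (Tm X arity) 7
      prems : List (Vec (Tm X arity) 7)
      side  : Tm X arity

  open Clause

  instances : ∀ {X V} → List (Vec (Tm X V) 7) → Vec ℕ V → List Goal
  instances ps v = List.map (λ p → ⟦ p ⟧* v) ps

  ClosedAt : ∀ {X} → (Goal → Set) → Clause X → Set
  ClosedAt I cl = ∀ v → ⟦ side cl ⟧ v ≡ 0 → All I (instances (prems cl) v) → I (⟦ concl cl ⟧* v)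

  -- The premises come with their derivations, because `bigLeaf` and `haltExtIntro` have to hand on
  -- the derivation of an `ev` goal and not its meaning.
  SoundAt : ∀ {X} → (Goal → Set) → (Goal → Set) → Clause X → Set
  SoundAt D I cl = ∀ v → ⟦ side cl ⟧ v ≡ 0 → All (λ g → D g × I g) (instances (prems cl) v) → I (⟦ concl cl ⟧* v)

  push : List Goal → ℕ → ℕ
  push []       r = r
  push (g ∷ gs) r = pr (encV g) (push gs r)

  push-++ : ∀ gs hs r → push (gs ++ hs) r ≡ push gs (push hs r)
  push-++ []       hs r = refl
  push-++ (g ∷ gs) hs r = cong (pr (encV g)) (push-++ gs hs r)

  -- The verifier keeps a stack of goals.  A move w = ⟨clause number, ⟨rest of the stack, variables⟩⟩
  -- replaces the top goal by the premises of the clause; an inapplicable move is skipped.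
  module _ {X : SetN} where
    vars : (cl : Clause X) → ℕ → Vec ℕ (arity cl)
    vars cl w = decV (arity cl) (snd (snd w))

    mismatch : ℕ → Clause X → ℕ → ℕ → ℕ
    mismatch j cl s w = dist (fst w) j +
      (dist s (pr (encV (⟦ concl cl ⟧* (vars cl w))) (fst (snd w))) + ⟦ side cl ⟧ (vars cl w))

    fire : Clause X → ℕ → ℕ
    fire cl w = push (instances (prems cl) (vars cl w)) (fst (snd w))

    step : ℕ → List (Clause X) → ℕ → ℕ → ℕ
    step j []         s w = s
    step j (cl ∷ cls) s w = ifz (mismatch j cl s w) (fire cl w) (step (suc j) cls s w)

    step-sound : ∀ j cls s w → step j cls s w ≡ s ⊎
      (Σ (Clause X) λ cl → cl ∈ cls × Σ (Vec ℕ (arity cl)) λ v → Σ ℕ λ r → ⟦ side cl ⟧ v ≡ 0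
        × s ≡ pr (encV (⟦ concl cl ⟧* v)) r × step j cls s w ≡ push (instances (prems cl) v) r)
    step-sound j []         s w = inj₁ refl
    step-sound j (cl ∷ cls) s w with mismatch j cl s w in eq
    ... | zero = inj₂ (cl , here refl , vars cl w , fst (snd w)
                      , m+n≡0⇒n≡0 (dist s _) eq' , dist≡0 s _ (m+n≡0⇒m≡0 (dist s _) eq') , refl)
      where
      eq' = m+n≡0⇒n≡0 (dist (fst w) j) eq
    ... | suc _ with step-sound (suc j) cls s w
    ...   | inj₁ p = inj₁ p
    ...   | inj₂ (cl' , cl'∈ , rest) = inj₂ (cl' , there cl'∈ , rest)

    step-skip : ∀ j cl cls s w → ¬ fst w ≡ j → step j (cl ∷ cls) s w ≡ step (suc j) cls s w
    step-skip j cl cls s w ≢ with mismatch j cl s w in eq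
    ... | zero  = ⊥-elim (≢ (dist≡0 (fst w) j (m+n≡0⇒m≡0 (dist (fst w) j) eq)))
    ... | suc _ = refl

    step-complete : ∀ j cls (i : Fin (length cls)) → let cl = List.lookup cls i in
      ∀ (v : Vec ℕ (arity cl)) r → ⟦ side cl ⟧ v ≡ 0 →
      step j cls (pr (encV (⟦ concl cl ⟧* v)) r) (pr (j + toℕ i) (pr r (encV v)))
        ≡ push (instances (prems cl) v) r
    step-complete j (cl ∷ cls) zero v r side≡0 = go (+-identityʳ j)
      where
      go : ∀ {k} → k ≡ j → step j (cl ∷ cls) (pr (encV (⟦ concl cl ⟧* v)) r) (pr k (pr r (encV v)))
                         ≡ push (instances (prems cl) v) r
      go {k} refl
        rewrite fst-pr k (pr r (encV v)) | snd-pr k (pr r (encV v)) | fst-pr r (encV v) | snd-pr r (encV v)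
              | decV-encV v | dist-refl k | dist-refl (pr (encV (⟦ concl cl ⟧* v)) r) | side≡0 = refl
    step-complete j (cl ∷ cls) (suc i) v r side≡0 = trans
      (step-skip j cl cls _ _ λ eq → m≢1+m+n j (trans (sym eq) (trans (fst-pr _ _) (+-suc j (toℕ i)))))
      (subst (λ k → step (suc j) cls (pr (encV (⟦ concl (List.lookup cls i) ⟧* v)) r) (pr k (pr r (encV v)))
                    ≡ push (instances (prems (List.lookup cls i)) v) r) (sym (+-suc j (toℕ i)))
        (step-complete (suc j) cls i v r side≡0))

    varsTm : (cl : Clause X) → Vec (Tm X 2) (arity cl)
    varsTm cl = decTm (arity cl) (ap1 sndFn (ap1 sndFn v1))

    onVars : (cl : Clause X) → Tm X (arity cl) → Tm X 2
    onVars cl t = app ⟦ t ⟧ (fn t) (varsTm cl)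

    onVars-correct : ∀ cl t s w → ⟦ onVars cl t ⟧ (s ∷ w ∷ []) ≡ ⟦ t ⟧ (vars cl w)
    onVars-correct cl t s w = cong ⟦ t ⟧ (decTm-correct (arity cl) (ap1 sndFn (ap1 sndFn v1)) (s ∷ w ∷ []))

    mismatchTm : ℕ → Clause X → Tm X 2
    mismatchTm j cl = ap2 addFn (ap2 distFn (ap1 fstFn v1) (con j)) (ap2 addFn
      (ap2 distFn v0 (ap2 prFn (onVars cl (encTm (concl cl))) (ap1 fstFn (ap1 sndFn v1))))
      (onVars cl (side cl)))

    mismatchTm-correct : ∀ j cl s w → ⟦ mismatchTm j cl ⟧ (s ∷ w ∷ []) ≡ mismatch j cl s w
    mismatchTm-correct j cl s w = cong (dist (fst w) j +_) (cong₂ _+_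
      (cong (λ c → dist s (pr c (fst (snd w))))
        (trans (onVars-correct cl (encTm (concl cl)) s w) (encTm-correct (concl cl) (vars cl w))))
      (onVars-correct cl (side cl) s w))

    pushTm : (cl : Clause X) → List (Vec (Tm X (arity cl)) 7) → Tm X 2
    pushTm cl []       = ap1 fstFn (ap1 sndFn v1)
    pushTm cl (p ∷ ps) = ap2 prFn (onVars cl (encTm p)) (pushTm cl ps)

    pushTm-correct : ∀ cl ps s w →
      ⟦ pushTm cl ps ⟧ (s ∷ w ∷ []) ≡ push (instances ps (vars cl w)) (fst (snd w))
    pushTm-correct cl []       s w = refl
    pushTm-correct cl (p ∷ ps) s w = cong₂ pr
      (trans (onVars-correct cl (encTm p) s w) (encTm-correct p (vars cl w)))
      (pushTm-correct cl ps s w)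

    stepTm : ℕ → List (Clause X) → Tm X 2
    stepTm j []         = v0
    stepTm j (cl ∷ cls) = if0 (mismatchTm j cl) (pushTm cl (prems cl)) (stepTm (suc j) cls)

    stepTm-correct : ∀ j cls s w → ⟦ stepTm j cls ⟧ (s ∷ w ∷ []) ≡ step j cls s w
    stepTm-correct j []         s w = refl
    stepTm-correct j (cl ∷ cls) s w
      rewrite mismatchTm-correct j cl s w | pushTm-correct cl (prems cl) s w
            | stepTm-correct (suc j) cls s w = refl

  drop : ℕ → ℕ → ℕ
  drop zero    W = W
  drop (suc k) W = snd (drop k W)

  dropFn : ∀ {X} → Fn₂ X drop
  dropFn = Fn₂-cong eq (precFn (fn v0) (fn (ap1 sndFn v1)))
    where
    eq : ∀ k W → natrec _ _ (k ∷ W ∷ []) ≡ drop k W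
    eq zero    W = refl
    eq (suc k) W = cong snd (eq k W)

  take : ℕ → ℕ → List ℕ
  take zero    W = []
  take (suc k) W = fst W ∷ take k (snd W)

  encL : List ℕ → ℕ
  encL []       = 0
  encL (w ∷ ws) = pr w (encL ws)

  take-encL : ∀ ws → take (length ws) (encL ws) ≡ ws
  take-encL []       = refl
  take-encL (w ∷ ws) = cong₂ _∷_ (fst-pr w (encL ws))
    (trans (cong (take (length ws)) (snd-pr w (encL ws))) (take-encL ws))

  snd-drop : ∀ k W → snd (drop k W) ≡ drop k (snd W)
  snd-drop zero    W = refl
  snd-drop (suc k) W = cong snd (snd-drop k W)

  module Verifier {X : SetN} (cls : List (Clause X)) where
    move : ℕ → ℕ → ℕ
    move = step 0 cls

    run : ℕ → ℕ → ℕ → ℕ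
    run zero    s W = s
    run (suc k) s W = move (run k s W) (fst (drop k W))

    runFn : Fn X 3 (un3 run)
    runFn = Fn-cong (λ { (k ∷ s ∷ W ∷ []) → eq k s W })
      (precFn (fn v0) (fn (app (⟦ stepTm 0 cls ⟧) (fn (stepTm 0 cls)) (v1 ∷ ap1 fstFn (ap2 dropFn v0 v3) ∷ []))))
      where
      eq : ∀ k s W → natrec _ _ (k ∷ s ∷ W ∷ []) ≡ run k s W
      eq zero    s W = refl
      eq (suc k) s W = trans (stepTm-correct 0 cls _ _) (cong (λ s → move s (fst (drop k W))) (eq k s W))

    -- Primitive recursion peels off the last move, a left fold the first; this equation passes from
    -- one to the other.
    run-suc : ∀ k s W → run (suc k) s W ≡ run k (move s (fst W)) (snd W)
    run-suc zero    s W = refl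
    run-suc (suc k) s W = cong₂ move (run-suc k s W) (cong fst (snd-drop k W))

    run-foldl : ∀ k s W → run k s W ≡ foldl move s (take k W)
    run-foldl zero    s W = refl
    run-foldl (suc k) s W = trans (run-suc k s W) (run-foldl k (move s (fst W)) (snd W))

    check : ℕ → ℕ → ℕ
    check w g = run (fst w) (pr g 0) (snd w)

    checkFn : Fn₂ X check
    checkFn = Fn₂-cong (λ _ _ → refl) (fn (app (un3 run) runFn (ap1 fstFn v0 ∷ ap2 prFn v1 (con 0) ∷ ap1 sndFn v0 ∷ [])))

    -- Quantifying over the rest `r` of the stack makes derivations composable: those of several
    -- premises run one after the other on a common stack.
    Der : Goal → Set
    Der g = ∀ r → Σ (List ℕ) λ ws → foldl move (pr (encV g) r) ws ≡ r

    Ders : ∀ gs → All Der gs → ∀ r → Σ (List ℕ) λ ws → foldl move (push gs r) ws ≡ r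
    Ders []       []       r = [] , refl
    Ders (g ∷ gs) (d ∷ ds) r with d (push gs r) | Ders gs ds r
    ... | ws , eq | us , eq' = ws ++ us ,
      trans (foldl-++ move _ ws us) (trans (cong (λ s → foldl move s us) eq) eq')

    derive : (j : Fin (length cls)) → ClosedAt Der (List.lookup cls j)
    derive j v side≡0 ds r with Ders _ ds r
    ... | ws , eq = pr (toℕ j) (pr r (encV v)) ∷ ws ,
      trans (cong (λ s → foldl move s ws) (step-complete 0 cls j v r side≡0)) eq

    -- Induction on the moves, read backwards from the empty stack: an effective move undoes the
    -- replacement of a conclusion by premises for which `I` is already known.
    foldl-sound : ∀ {I : Goal → Set} → All (ClosedAt I) cls → ∀ ws gs → foldl move (push gs 0) ws ≡ 0 → All I gs
    foldl-sound closed []       []       eq = []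
    foldl-sound closed []       (g ∷ gs) eq = ⊥-elim (0≢pr (sym eq))
    foldl-sound closed (w ∷ ws) gs       eq with step-sound 0 cls (push gs 0) w
    ... | inj₁ same = foldl-sound closed ws gs (trans (cong (λ s → foldl move s ws) (sym same)) eq)
    ... | inj₂ (cl , cl∈ , v , r , side≡0 , top , new) with gs
    ...   | []      = ⊥-elim (0≢pr top)
    ...   | g ∷ gs' with pr-injective top
    ...     | p , refl with encV-injective g (⟦ Clause.concl cl ⟧* v) p
    ...       | refl with ++⁻ (instances (Clause.prems cl) v) (foldl-sound closed ws
                            (instances (Clause.prems cl) v ++ gs')
                            (trans (cong (λ s → foldl move s ws)
                              (trans (push-++ (instances (Clause.prems cl) v) gs' 0) (sym new))) eq))
    ...         | ps , rest = All.lookup closed cl∈ v side≡0 ps ∷ rest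

    Der→check : ∀ g → Der g → Σ ℕ λ w → check w (encV g) ≡ 0
    Der→check g d with d 0
    ... | ws , eq = pr (length ws) (encL ws) , trans
      (trans (cong₂ (λ k W → run k (pr (encV g) 0) W) (fst-pr (length ws) (encL ws)) (snd-pr (length ws) (encL ws)))
        (trans (run-foldl (length ws) _ (encL ws)) (cong (foldl move (pr (encV g) 0)) (take-encL ws)))) eq

    check→ : ∀ {I : Goal → Set} → All (ClosedAt I) cls → ∀ g w → check w (encV g) ≡ 0 → I g
    check→ closed g w eq with foldl-sound closed (take (fst w) (snd w)) (g ∷ []) (trans (sym (run-foldl (fst w) _ (snd w))) eq)
    ... | p ∷ [] = p

    Der-closed : All (ClosedAt Der) cls
    Der-closed = All.tabulate λ {cl} cl∈ v side≡0 ds → subst (λ c → ClosedAt Der c) (sym (lookup-index cl∈)) (derive (Any.index cl∈)) v side≡0 ds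

    check→Der : ∀ g w → check w (encV g) ≡ 0 → Der g
    check→Der g w = check→ {Der} Der-closed g w

    Der-elim : ∀ {I : Goal → Set} → All (SoundAt Der I) cls → ∀ {g} → Der g → I g
    Der-elim {I} sound {g} d with Der→check g d
    ... | w , eq = proj₂ (check→ {λ g → Der g × I g} (All.tabulate {P = ClosedAt λ g → Der g × I g} both) g w eq)
      where
      both : ∀ {cl} → cl ∈ cls → ClosedAt (λ g → Der g × I g) cl
      both cl∈ v side≡0 ps = All.lookup {P = ClosedAt Der} Der-closed cl∈ v side≡0 (All.map proj₁ ps)
                           , All.lookup {P = SoundAt Der I} sound cl∈ v side≡0 ps

  -- A universal system of Horn clauses

  -- A string is listed from its last letter to its first.
  String : Set
  String = List ℕ

  data At : String → ℕ → ℕ → Set where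
    here  : ∀ {σ v} → At (v ∷ σ) (length σ) v
    there : ∀ {σ n u v} → At σ n v → At (u ∷ σ) n v

  infix 4 _≽_
  data _≽_ : String → String → Set where
    done : ∀ {σ} → σ ≽ σ
    more : ∀ {n τ σ} → τ ≽ σ → n ∷ τ ≽ σ

  ≽-trans : ∀ {ρ τ σ} → ρ ≽ τ → τ ≽ σ → ρ ≽ σ
  ≽-trans done     q = q
  ≽-trans (more p) q = more (≽-trans p q)

  -- Each letter is stored with its position, so the code lists a finite part of a graph and `mem`
  -- finds a letter without counting.
  encS : String → ℕ
  encS []      = 0
  encS (v ∷ σ) = pr (pr (length σ) v) (encS σ)

  mutual
    -- An element is the finite `k`-bushy tree itself. `BigN` lists the children of a node in
    -- increasing order, which makes them distinct.
    data Big (k : ℕ) (C : String → Set) : String → Set where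
      leaf : ∀ {σ} → C σ → Big k C σ
      node : ∀ {σ} → BigN k C k 0 σ → Big k C σ

    -- At least j of the children n ∷ σ with n ≥ b are big.
    data BigN (k : ℕ) (C : String → Set) : ℕ → ℕ → String → Set where
      none : ∀ {b σ} → BigN k C 0 b σ
      some : ∀ {j b σ} n → b ≤ n → Big k C (n ∷ σ) → BigN k C j (suc n) σ → BigN k C (suc j) b σ

  -- The characteristic function at `x` of the graph {⟪n , f n⟫}, where `u` is the value of f at
  -- `fst x`.
  graphBit : ℕ → ℕ → ℕ
  graphBit u x = ifz (dist u (snd x)) 1 0

  -- Abstracting the constants lets one list of forms serve for numerical goals (`G`) and for the
  -- patterns in clauses (`T`); evaluating the latter gives the former definitionally.
  module GoalForms {A : Set} (κ : ℕ → A) where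
    ev : (π n e l y : A) → Vec A 7
    ev π n e l y = κ 0 ∷ π ∷ n ∷ e ∷ l ∷ y ∷ κ 0 ∷ []

    evV : (π n m b l ys : A) → Vec A 7
    evV π n m b l ys = κ 1 ∷ π ∷ n ∷ m ∷ b ∷ l ∷ ys ∷ []

    below : (π n a k l : A) → Vec A 7
    below π n a k l = κ 2 ∷ π ∷ n ∷ a ∷ k ∷ l ∷ κ 0 ∷ []

    nth : (l i y : A) → Vec A 7
    nth l i y = κ 3 ∷ l ∷ i ∷ y ∷ κ 0 ∷ κ 0 ∷ κ 0 ∷ []

    dec : (n e : A) → Vec A 7
    dec n e = κ 4 ∷ n ∷ e ∷ κ 0 ∷ κ 0 ∷ κ 0 ∷ κ 0 ∷ []

    decs : (n m b : A) → Vec A 7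
    decs n m b = κ 5 ∷ n ∷ m ∷ b ∷ κ 0 ∷ κ 0 ∷ κ 0 ∷ []

    mem : (l x : A) → Vec A 7
    mem l x = κ 6 ∷ l ∷ x ∷ κ 0 ∷ κ 0 ∷ κ 0 ∷ κ 0 ∷ []

    orcl : (π x b : A) → Vec A 7
    orcl π x b = κ 7 ∷ π ∷ x ∷ b ∷ κ 0 ∷ κ 0 ∷ κ 0 ∷ []

    big : (k σ l q : A) → Vec A 7
    big k σ l q = κ 8 ∷ k ∷ σ ∷ l ∷ q ∷ κ 0 ∷ κ 0 ∷ []

    bigN : (k j b σ l q : A) → Vec A 7
    bigN k j b σ l q = κ 9 ∷ k ∷ j ∷ b ∷ σ ∷ l ∷ q ∷ []

    ext : (τ m σ l : A) → Vec A 7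
    ext τ m σ l = κ 10 ∷ τ ∷ m ∷ σ ∷ l ∷ κ 0 ∷ κ 0 ∷ []

    haltExt : (p e q : A) → Vec A 7
    haltExt p e q = κ 11 ∷ p ∷ e ∷ q ∷ κ 0 ∷ κ 0 ∷ κ 0 ∷ []

  module G = GoalForms (λ (k : ℕ) → k)

  v4 : ∀ {X V} → Tm X (5 + V)
  v4 = var (suc (suc (suc (suc zero))))

  v5 : ∀ {X V} → Tm X (6 + V)
  v5 = var (suc (suc (suc (suc (suc zero)))))

  v6 : ∀ {X V} → Tm X (7 + V)
  v6 = var (suc (suc (suc (suc (suc (suc zero))))))

  v7 : ∀ {X V} → Tm X (8 + V)
  v7 = var (suc (suc (suc (suc (suc (suc (suc zero)))))))

  sc : ∀ {X V} → Tm X V → Tm X V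
  sc = ap1 sucFn

  infixr 5 _&_
  _&_ : ∀ {X V} → Tm X V → Tm X V → Tm X V
  _&_ = ap2 prFn

  -- In these clauses π encodes the oracle: 0 stands for Z, and suc (encS τ) for Z together
  -- with the part of a graph {⟪n , f n⟫} that is determined by the string τ.
  module System (Z : SetN) where
    open module T {V : ℕ} = GoalForms (con {Z} {V})

    evZero : Clause Z
    evZero = clause 3 (ev v0 v1 (con 0 & con 0) v2 (con 0)) [] (con 0)

    evSucc : Clause Z
    evSucc = clause 2 (ev v0 (con 1) (con 1 & con 0) (v1 & con 0) (sc v1)) [] (con 0)

    evProj : Clause Z
    evProj = clause 5 (ev v0 v1 (con 2 & v2) v3 v4) (nth v3 v2 v4 ∷ []) (ap2 monusFn (sc v2) v1)

    evOrc : Clause Z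
    evOrc = clause 3 (ev v0 (con 1) (con 3 & con 0) (v1 & con 0) v2) (orcl v0 v1 v2 ∷ []) (con 0)

    evComp : Clause Z
    evComp = clause 8 (ev v0 v1 (con 4 & v2 & v3 & v4) v5 v6)
        (evV v0 v1 v2 v4 v5 v7 ∷ ev v0 v2 v3 v7 v6 ∷ []) (con 0)

    -- At 0 the step program is not run, but it must be certified by `dec`, or the whole number need
    -- not code a program. In `evPrecS` the `dec` premise lets `gn-injective` recognise the code
    -- found for the recursive call as a `prec`.
    evPrec0 : Clause Z
    evPrec0 = clause 6 (ev v0 (sc v1) (con 5 & v2 & v3) (con 0 & v4) v5)
        (ev v0 v1 v2 v4 v5 ∷ dec (sc (sc v1)) v3 ∷ []) (con 0)

    evPrecS : Clause Z
    evPrecS = clause 8 (ev v0 (sc v1) (con 5 & v2 & v3) (sc v4 & v5) v6)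
        (ev v0 (sc v1) (con 5 & v2 & v3) (v4 & v5) v7 ∷ ev v0 (sc (sc v1)) v3 (v4 & v7 & v5) v6
        ∷ dec v1 v2 ∷ []) (con 0)

    evMu : Clause Z
    evMu = clause 5 (ev v0 v1 (con 6 & v2) v3 v4)
        (ev v0 (sc v1) v2 (v4 & v3) (con 0) ∷ below v0 v1 v2 v4 v3 ∷ []) (con 0)

    evsNil : Clause Z
    evsNil = clause 3 (evV v0 v1 (con 0) (con 0) v2 (con 0)) [] (con 0)

    evsCons : Clause Z
    evsCons = clause 8 (evV v0 v1 (sc v2) (v3 & v4) v5 (v6 & v7))
        (ev v0 v1 v3 v5 v6 ∷ evV v0 v1 v2 v4 v5 v7 ∷ []) (con 0)

    below0 : Clause Z
    below0 = clause 4 (below v0 v1 v2 (con 0) v3) [] (con 0)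

    belowS : Clause Z
    belowS = clause 6 (below v0 v1 v2 (sc v3) v4)
        (below v0 v1 v2 v3 v4 ∷ ev v0 (sc v1) v2 (v3 & v4) (sc v5) ∷ []) (con 0)

    nth0 : Clause Z
    nth0 = clause 2 (nth (v0 & v1) (con 0) v0) [] (con 0)

    nthS : Clause Z
    nthS = clause 4 (nth (v0 & v1) (sc v2) v3) (nth v1 v2 v3 ∷ []) (con 0)

    decZero : Clause Z
    decZero = clause 1 (dec v0 (con 0 & con 0)) [] (con 0)

    decSucc : Clause Z
    decSucc = clause 0 (dec (con 1) (con 1 & con 0)) [] (con 0)

    decProj : Clause Z
    decProj = clause 2 (dec v0 (con 2 & v1)) [] (ap2 monusFn (sc v1) v0)

    decOrc : Clause Z
    decOrc = clause 0 (dec (con 1) (con 3 & con 0)) [] (con 0)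

    decComp : Clause Z
    decComp = clause 4 (dec v0 (con 4 & v1 & v2 & v3)) (dec v1 v2 ∷ decs v0 v1 v3 ∷ []) (con 0)

    decPrec : Clause Z
    decPrec = clause 3 (dec (sc v0) (con 5 & v1 & v2)) (dec v0 v1 ∷ dec (sc (sc v0)) v2 ∷ []) (con 0)

    decMu : Clause Z
    decMu = clause 2 (dec v0 (con 6 & v1)) (dec (sc v0) v1 ∷ []) (con 0)

    decsNil : Clause Z
    decsNil = clause 1 (decs v0 (con 0) (con 0)) [] (con 0)

    decsCons : Clause Z
    decsCons = clause 4 (decs v0 (sc v1) (v2 & v3)) (dec v0 v2 ∷ decs v0 v1 v3 ∷ []) (con 0)

    memHere : Clause Z
    memHere = clause 2 (mem (v0 & v1) v0) [] (con 0)

    memThere : Clause Z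
    memThere = clause 3 (mem (v0 & v1) v2) (mem v1 v2 ∷ []) (con 0)

    orclDirect : Clause Z
    orclDirect = clause 2 (orcl (con 0) v0 v1) [] (ap2 distFn (ap1 χFn v0) v1)

    orclLeft : Clause Z
    orclLeft = clause 3 (orcl (sc v0) (ap2 mulFn (con 2) v1) v2) [] (ap2 distFn (ap1 χFn v1) v2)

    -- Even a negative answer requires the letter at position `fst x`; beyond its length the string
    -- answers nothing about the graph.
    orclRight : Clause Z
    orclRight = clause 4 (orcl (sc v0) (sc (ap2 mulFn (con 2) v1)) v2) (mem v0 (ap1 fstFn v1 & v3) ∷ [])
        (ap2 distFn (if0 (ap2 distFn v3 (ap1 sndFn v1)) (con 1) (con 0)) v2)

    bigLeaf : Clause Z
    bigLeaf = clause 6 (big v0 v1 v2 (v3 & v4 & v5)) (ev (sc v1) (con 1) v3 (v4 & con 0) v5 ∷ []) (con 0)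

    bigNode : Clause Z
    bigNode = clause 4 (big v0 v1 v2 v3) (bigN v0 v0 (con 0) v1 v2 v3 ∷ []) (con 0)

    bigN0 : Clause Z
    bigN0 = clause 5 (bigN v0 (con 0) v1 v2 v3 v4) [] (con 0)

    -- Goals about strings carry the length, since the code of `n ∷ σ` stores it as the position of
    -- the new letter.
    bigNS : Clause Z
    bigNS = clause 7 (bigN v0 (sc v1) v2 v3 v4 v5)
        (big v0 ((v4 & v6) & v3) (sc v4) v5 ∷ bigN v0 v1 (sc v6) v3 v4 v5 ∷ []) (ap2 monusFn v2 v6)

    extDone : Clause Z
    extDone = clause 2 (ext v0 v1 v0 v1) [] (con 0)

    extMore : Clause Z
    extMore = clause 5 (ext ((v1 & v2) & v0) (sc v1) v3 v4) (ext v0 v1 v3 v4 ∷ []) (con 0)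

    haltExtIntro : Clause Z
    haltExtIntro = clause 6 (haltExt (v0 & v1) v2 (v3 & v4))
        (ext v3 v4 v0 v1 ∷ ev (sc v3) (con 1) v2 (v2 & con 0) v5 ∷ []) (con 0)

    clauses : List (Clause Z)
    clauses =
      evZero ∷ evSucc ∷ evProj ∷ evOrc ∷ evComp ∷ evPrec0 ∷
      evPrecS ∷ evMu ∷ evsNil ∷ evsCons ∷ below0 ∷ belowS ∷
      nth0 ∷ nthS ∷ decZero ∷ decSucc ∷ decProj ∷ decOrc ∷
      decComp ∷ decPrec ∷ decMu ∷ decsNil ∷ decsCons ∷ memHere ∷
      memThere ∷ orclDirect ∷ orclLeft ∷ orclRight ∷ bigLeaf ∷ bigNode ∷
      bigN0 ∷ bigNS ∷ extDone ∷ extMore ∷ haltExtIntro ∷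
      []

    private module V = Verifier clauses

    -- Opaque, so that normal forms do not contain the list of clauses.
    opaque
      Der : Goal → Set
      Der = V.Der

      check : ℕ → ℕ → ℕ
      check = V.check

      checkFn : Fn₂ Z check
      checkFn = V.checkFn

      derive : (j : Fin (length clauses)) → ClosedAt Der (List.lookup clauses j)
      derive = V.derive

      Der→check : ∀ g → Der g → Σ ℕ λ w → check w (encV g) ≡ 0
      Der→check = V.Der→check

      check→Der : ∀ g w → check w (encV g) ≡ 0 → Der g
      check→Der = V.check→Der

      Der-elim : ∀ {I : Goal → Set} → All (SoundAt Der I) clauses → ∀ {g} → Der g → I g
      Der-elim = V.Der-elim

    -- The forcing relation: the string `τ` makes program `e` on `x` yield `y`. Being derivability,
    -- it is Σ₁ in `Z`.
    DerEv : String → ℕ → ℕ → ℕ → Set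
    DerEv τ e x y = Der (G.ev (suc (encS τ)) 1 e (pr x 0) y)

    -- Meaning of the goals for an oracle X of which the codes π with Compat π encode a part.
    module Meaning (X : SetN) (Compat : ℕ → Set) where
      I : Goal → Set
      I (0 ∷ π ∷ n ∷ e ∷ l ∷ y ∷ _ ∷ []) =
        Compat π → (xs : Vec ℕ n) → encV xs ≡ l → Σ (Code n) λ c → gn c ≡ e × Eval X c xs y
      I (1 ∷ π ∷ n ∷ m ∷ b ∷ l ∷ ys ∷ []) =
        Compat π → (xs : Vec ℕ n) → encV xs ≡ l → Σ (Vec (Code n) m) λ cs → gnV cs ≡ b
          × Σ (Vec ℕ m) λ zs → encV zs ≡ ys × EvalV X xs cs zs
      -- The code is given here and not produced: for `k = 0` no premise could supply one.
      I (2 ∷ π ∷ n ∷ a ∷ k ∷ l ∷ _ ∷ []) =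
        Compat π → (f : Code (suc n)) (xs : Vec ℕ n) → gn f ≡ a → encV xs ≡ l →
        ∀ j → j < k → Σ ℕ λ v → Eval X f (j ∷ xs) (suc v)
      I (3 ∷ l ∷ i ∷ y ∷ _ ∷ _ ∷ _ ∷ []) =
        ∀ {n} (xs : Vec ℕ n) (j : Fin n) → encV xs ≡ l → toℕ j ≡ i → lookup xs j ≡ y
      I (4 ∷ n ∷ e ∷ _) = Σ (Code n) λ c → gn c ≡ e
      I (5 ∷ n ∷ m ∷ b ∷ _) = Σ (Vec (Code n) m) λ cs → gnV cs ≡ b
      I (6 ∷ l ∷ x ∷ _) = ∀ σ → encS σ ≡ l → Σ ℕ λ n → Σ ℕ λ v → x ≡ pr n v × At σ n v
      I (7 ∷ π ∷ x ∷ b ∷ _) = Compat π → χ X x ≡ b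
      I (8 ∷ k ∷ σ ∷ l ∷ q ∷ _) =
        ∀ s → encS s ≡ σ → length s ≡ l → ∀ e x i → q ≡ pr e (pr x i) → Big k (λ τ → DerEv τ e x i) s
      I (9 ∷ k ∷ j ∷ b ∷ σ ∷ l ∷ q ∷ []) =
        ∀ s → encS s ≡ σ → length s ≡ l → ∀ e x i → q ≡ pr e (pr x i) → BigN k (λ τ → DerEv τ e x i) j b s
      I (10 ∷ τ ∷ m ∷ σ ∷ l ∷ _) =
        ∀ s → encS s ≡ σ → length s ≡ l → Σ String λ t → encS t ≡ τ × length t ≡ m × t ≽ s
      I (11 ∷ p ∷ e ∷ q ∷ _) =
        ∀ s → p ≡ pr (encS s) (length s) → Σ String λ t → q ≡ pr (encS t) (length t) × t ≽ s × Σ ℕ λ y → DerEv t e e y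
      I _ = ⊤

      OracleSound : Set
      OracleSound =
        (∀ x → Compat 0 → χ X x ≡ χ Z x) ×
        (∀ τ x → Compat (suc τ) → χ X (2 * x) ≡ χ Z x) ×
        (∀ τ x u → Compat (suc τ) → I (G.mem τ (pr (fst x) u)) → χ X (suc (2 * x)) ≡ graphBit u x)

      sound : OracleSound → All (SoundAt Der I) clauses
      sound (orc₁ , orc₂ , orc₃) =
          (λ { (π ∷ n ∷ l ∷ []) _ [] ok xs _ → zer , refl , ev-zer })
        ∷ (λ { (π ∷ x ∷ []) _ [] ok (x' ∷ []) eq → succ , refl , succ-sound eq })
        ∷ (λ { (π ∷ n ∷ i ∷ l ∷ y ∷ []) i<n ((_ , ih) ∷ []) ok xs eq →
               let i<n' = m∸n≡0⇒m≤n i<n in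
               proj (fromℕ< i<n') , cong (pr 2) (toℕ-fromℕ< i<n') ,
               subst (Eval X _ xs) (ih xs (fromℕ< i<n') eq (toℕ-fromℕ< i<n')) (ev-proj _) })
        ∷ (λ { (π ∷ x ∷ b ∷ []) _ ((_ , ih) ∷ []) ok (x' ∷ []) eq → orc , refl ,
               subst₂ (λ x b → Eval X orc (x ∷ []) b) (sym (proj₁ (pr-injective eq))) (ih ok) (orc-χ X x) })
        ∷ (λ { (π ∷ n ∷ m ∷ a ∷ b ∷ l ∷ z ∷ ys ∷ []) _ ((_ , ihs) ∷ (_ , ih) ∷ []) ok xs eq →
               comp-sound (ihs ok xs eq) (ih ok) })
        ∷ (λ { (π ∷ n ∷ a ∷ b ∷ l ∷ z ∷ []) _ ((_ , ih) ∷ (_ , d) ∷ []) ok (k ∷ xs) eq →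
               prec0-sound (ih ok xs (proj₂ (pr-injective eq))) d (proj₁ (pr-injective eq)) })
        ∷ (λ { (π ∷ n ∷ a ∷ b ∷ k ∷ l ∷ z ∷ w ∷ []) _ ((_ , ih) ∷ (_ , ih') ∷ (_ , d) ∷ []) ok (k' ∷ xs) eq →
               precS-sound (proj₁ (pr-injective eq))
                 (ih ok (k ∷ xs) (cong (pr k) (proj₂ (pr-injective eq))))
                 (ih' ok (k ∷ w ∷ xs) (cong (λ l → pr k (pr w l)) (proj₂ (pr-injective eq)))) d })
        ∷ (λ { (π ∷ n ∷ a ∷ l ∷ k ∷ []) _ ((_ , ih) ∷ (_ , ih') ∷ []) ok xs eq →
               mu-sound xs eq (ih ok (k ∷ xs) (cong (pr k) eq)) (ih' ok) })
        ∷ (λ { (π ∷ n ∷ l ∷ []) _ [] ok xs eq → [] , refl , [] , refl , evv-[] })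
        ∷ (λ { (π ∷ n ∷ m ∷ a ∷ b ∷ l ∷ y ∷ ys ∷ []) _ ((_ , ih) ∷ (_ , ihs) ∷ []) ok xs eq →
               cons-sound (ih ok xs eq) (ihs ok xs eq) })
        ∷ (λ { (π ∷ n ∷ a ∷ l ∷ []) _ [] ok f xs eq eq' j () })
        ∷ (λ { (π ∷ n ∷ a ∷ k ∷ l ∷ v ∷ []) _ ((_ , ih) ∷ (_ , ih') ∷ []) ok f xs eq eq' j j<1+k →
               below-sound f xs eq (ih ok f xs eq eq') (ih' ok (k ∷ xs) (cong (pr k) eq')) j j<1+k })
        ∷ (λ { (y ∷ l ∷ []) _ [] (x ∷ xs) zero eq _ → proj₁ (pr-injective eq) })
        ∷ (λ { (x ∷ l ∷ i ∷ y ∷ []) _ ((_ , ih) ∷ []) (_ ∷ xs) (suc j) eq eq' →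
               ih xs j (proj₂ (pr-injective eq)) (suc-injective eq') })
        ∷ (λ { (n ∷ []) _ [] → zer , refl })
        ∷ (λ { [] _ [] → succ , refl })
        ∷ (λ { (n ∷ i ∷ []) i<n [] → proj (fromℕ< (m∸n≡0⇒m≤n i<n)) , cong (pr 2) (toℕ-fromℕ< (m∸n≡0⇒m≤n i<n)) })
        ∷ (λ { [] _ [] → orc , refl })
        ∷ (λ { (n ∷ m ∷ a ∷ b ∷ []) _ ((_ , f , refl) ∷ (_ , gs , refl) ∷ []) → comp f gs , refl })
        ∷ (λ { (n ∷ a ∷ b ∷ []) _ ((_ , f , refl) ∷ (_ , g , refl) ∷ []) → prec f g , refl })
        ∷ (λ { (n ∷ a ∷ []) _ ((_ , f , refl) ∷ []) → mu f , refl })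
        ∷ (λ { (n ∷ []) _ [] → [] , refl })
        ∷ (λ { (n ∷ m ∷ a ∷ b ∷ []) _ ((_ , g , refl) ∷ (_ , gs , refl) ∷ []) → g ∷ gs , refl })
        ∷ (λ { (x ∷ l ∷ []) _ [] σ eq → mem-here-sound σ eq })
        ∷ (λ { (y ∷ l ∷ x ∷ []) _ ((_ , ih) ∷ []) σ eq → mem-there-sound ih σ eq })
        ∷ (λ { (x ∷ b ∷ []) eq [] ok → trans (orc₁ x ok) (dist≡0 _ _ eq) })
        ∷ (λ { (τ ∷ x ∷ b ∷ []) eq [] ok → trans (orc₂ τ x ok) (dist≡0 _ _ eq) })
        ∷ (λ { (τ ∷ x ∷ b ∷ u ∷ []) eq ((_ , ih) ∷ []) ok → trans (orc₃ τ x u ok ih) (dist≡0 _ _ eq) })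
        ∷ (λ { (k ∷ _ ∷ _ ∷ e ∷ x ∷ i ∷ []) _ ((d , _) ∷ []) s refl _ e' x' i' eq → leaf-sound eq d })
        ∷ (λ { (k ∷ σ ∷ l ∷ q ∷ []) _ ((_ , ih) ∷ []) s eq eq' e x i eq'' → node (ih s eq eq' e x i eq'') })
        ∷ (λ { (k ∷ b ∷ σ ∷ l ∷ q ∷ []) _ [] s _ _ e x i _ → none })
        ∷ (λ { (k ∷ j ∷ b ∷ σ ∷ l ∷ q ∷ n ∷ []) b≤n ((_ , ih) ∷ (_ , ih') ∷ []) s refl refl e x i eq →
               some n (m∸n≡0⇒m≤n b≤n) (ih (n ∷ s) refl refl e x i eq) (ih' s refl refl e x i eq) })
        ∷ (λ { (τ ∷ l ∷ []) _ [] s eq eq' → s , eq , eq' , done })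
        ∷ (λ { (τ ∷ m ∷ v ∷ σ ∷ l ∷ []) _ ((_ , ih) ∷ []) s eq eq' → ext-sound (ih s eq eq') })
        ∷ (λ { (σ ∷ l ∷ e ∷ τ ∷ m ∷ y ∷ []) _ ((_ , ih) ∷ (d , _) ∷ []) s eq →
               haltExt-sound (ih s (sym (proj₁ (pr-injective eq))) (sym (proj₂ (pr-injective eq)))) d })
        ∷ []
        where
        succ-sound : ∀ {x x' r r'} → pr x' r ≡ pr x r' → Eval X succ (x' ∷ []) (suc x)
        succ-sound eq with pr-injective eq
        ... | refl , _ = ev-succ

        comp-sound : ∀ {n m a b ys z} {xs : Vec ℕ n} →
          (Σ (Vec (Code n) m) λ cs → gnV cs ≡ b × Σ (Vec ℕ m) λ zs → encV zs ≡ ys × EvalV X xs cs zs) →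
          ((zs : Vec ℕ m) → encV zs ≡ ys → Σ (Code m) λ c → gn c ≡ a × Eval X c zs z) →
          Σ (Code n) λ c → gn c ≡ pr 4 (pr m (pr a b)) × Eval X c xs z
        comp-sound (cs , refl , zs , eq , evs) ih with ih zs eq
        ... | c , refl , e = comp c cs , refl , ev-comp evs e

        prec0-sound : ∀ {n a b z k} {xs : Vec ℕ n} → (Σ (Code n) λ c → gn c ≡ a × Eval X c xs z) →
          (Σ (Code (suc (suc n))) λ c → gn c ≡ b) → k ≡ 0 →
          Σ (Code (suc n)) λ c → gn c ≡ pr 5 (pr a b) × Eval X c (k ∷ xs) z
        prec0-sound (f , refl , e) (g , refl) refl = prec f g , refl , ev-prec0 e

        precS-sound : ∀ {n a b z k k' w} {xs : Vec ℕ n} → k' ≡ suc k →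
          (Σ (Code (suc n)) λ c → gn c ≡ pr 5 (pr a b) × Eval X c (k ∷ xs) w) →
          (Σ (Code (suc (suc n))) λ c → gn c ≡ b × Eval X c (k ∷ w ∷ xs) z) →
          (Σ (Code n) λ c → gn c ≡ a) →
          Σ (Code (suc n)) λ c → gn c ≡ pr 5 (pr a b) × Eval X c (k' ∷ xs) z
        precS-sound refl (c , eq , e) (g , refl , e') (f , refl) with gn-injective c (prec f g) eq
        ... | refl = prec f g , refl , ev-precS e e'

        mu-sound : ∀ {n a l k} (xs : Vec ℕ n) → encV xs ≡ l →
          (Σ (Code (suc n)) λ c → gn c ≡ a × Eval X c (k ∷ xs) 0) →
          ((f : Code (suc n)) (xs : Vec ℕ n) → gn f ≡ a → encV xs ≡ l → ∀ j → j < k → Σ ℕ λ v → Eval X f (j ∷ xs) (suc v)) →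
          Σ (Code n) λ c → gn c ≡ pr 6 a × Eval X c xs k
        mu-sound xs eq (f , refl , e) h = mu f , refl , ev-mu e (h f xs refl eq)

        cons-sound : ∀ {n m a b y ys} {xs : Vec ℕ n} → (Σ (Code n) λ c → gn c ≡ a × Eval X c xs y) →
          (Σ (Vec (Code n) m) λ cs → gnV cs ≡ b × Σ (Vec ℕ m) λ zs → encV zs ≡ ys × EvalV X xs cs zs) →
          Σ (Vec (Code n) (suc m)) λ cs → gnV cs ≡ pr a b × Σ (Vec ℕ (suc m)) λ zs → encV zs ≡ pr y ys × EvalV X xs cs zs
        cons-sound (c , refl , e) (cs , refl , zs , refl , es) = c ∷ cs , refl , _ ∷ zs , refl , evv-∷ e es

        below-sound : ∀ {n a k v} (f : Code (suc n)) (xs : Vec ℕ n) → gn f ≡ a →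
          (∀ j → j < k → Σ ℕ λ v → Eval X f (j ∷ xs) (suc v)) →
          (Σ (Code (suc n)) λ c → gn c ≡ a × Eval X c (k ∷ xs) (suc v)) →
          ∀ j → j < suc k → Σ ℕ λ v → Eval X f (j ∷ xs) (suc v)
        below-sound {k = k} f xs refl h (c , eq , e) j j<1+k with m≤n⇒m<n∨m≡n (s≤s⁻¹ j<1+k)
        ... | inj₁ j<k = h j j<k
        ... | inj₂ refl with gn-injective c f eq
        ...   | refl = _ , e

        mem-here-sound : ∀ {x l} σ → encS σ ≡ pr x l → Σ ℕ λ n → Σ ℕ λ v → x ≡ pr n v × At σ n v
        mem-here-sound []      eq = ⊥-elim (0≢pr eq)
        mem-here-sound (v ∷ σ) eq = length σ , v , sym (proj₁ (pr-injective eq)) , here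

        mem-there-sound : ∀ {x y l} → (∀ σ → encS σ ≡ l → Σ ℕ λ n → Σ ℕ λ v → x ≡ pr n v × At σ n v) →
          ∀ σ → encS σ ≡ pr y l → Σ ℕ λ n → Σ ℕ λ v → x ≡ pr n v × At σ n v
        mem-there-sound ih []      eq = ⊥-elim (0≢pr eq)
        mem-there-sound ih (u ∷ σ) eq with ih σ (proj₂ (pr-injective eq))
        ... | n , v , p , at = n , v , p , there at

        leaf-sound : ∀ {k e x i e' x' i' s} → pr e (pr x i) ≡ pr e' (pr x' i') → DerEv s e x i →
          Big k (λ τ → DerEv τ e' x' i') s
        leaf-sound eq d with pr-injective eq
        ... | refl , eq' with pr-injective eq'
        ...   | refl , refl = leaf d

        ext-sound : ∀ {τ m v s} → (Σ String λ t → encS t ≡ τ × length t ≡ m × t ≽ s) →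
          Σ String λ t → encS t ≡ pr (pr m v) τ × length t ≡ suc m × t ≽ s
        ext-sound {v = v} (t , refl , refl , t≽s) = v ∷ t , refl , refl , more t≽s

        haltExt-sound : ∀ {τ m e y s} → (Σ String λ t → encS t ≡ τ × length t ≡ m × t ≽ s) →
          Der (G.ev (suc τ) 1 e (pr e 0) y) →
          Σ String λ t → pr τ m ≡ pr (encS t) (length t) × t ≽ s × Σ ℕ λ y → DerEv t e e y
        haltExt-sound (t , refl , refl , t≽s) d = t , refl , t≽s , _ , d

      opaque
        meaning : OracleSound → ∀ {g} → Der g → I g
        meaning oracle = Der-elim {I} (sound oracle)

  -- Completeness of the clauses for true facts

  Eventually : (ℕ → Set) → Set
  Eventually Q = Σ ℕ λ s → ∀ t → s ≤ t → Q t

  always : ∀ {Q : ℕ → Set} → (∀ t → Q t) → Eventually Q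
  always q = 0 , λ t _ → q t

  eventually-map : ∀ {Q R : ℕ → Set} → (∀ t → Q t → R t) → Eventually Q → Eventually R
  eventually-map f (s , q) = s , λ t s≤t → f t (q t s≤t)

  eventually-both : ∀ {Q R S : ℕ → Set} → (∀ t → Q t → R t → S t) → Eventually Q → Eventually R → Eventually S
  eventually-both f (s , q) (s' , r) = s ⊔ s' , λ t le →
    f t (q t (≤-trans (m≤m⊔n s s') le)) (r t (≤-trans (m≤n⊔m s s') le))

  -- The argument # j of derive is a position in the list of clauses.
  module Completeness (Z : SetN) where
    open System Z
    open G

    mutual
      dec-complete : ∀ {n} (c : Code n) → Der (dec n (gn c))
      dec-complete {n} zer         = derive (# 14) (n ∷ []) refl []
      dec-complete succ            = derive (# 15) [] refl []
      dec-complete {n} (proj i)    = derive (# 16) (n ∷ toℕ i ∷ []) (m≤n⇒m∸n≡0 (toℕ<n i)) []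
      dec-complete orc             = derive (# 17) [] refl []
      dec-complete {n} (comp {m} f gs) = derive (# 18) (n ∷ m ∷ gn f ∷ gnV gs ∷ []) refl
        (dec-complete f ∷ decs-complete gs ∷ [])
      dec-complete {suc n} (prec f g)  = derive (# 19) (n ∷ gn f ∷ gn g ∷ []) refl
        (dec-complete f ∷ dec-complete g ∷ [])
      dec-complete {n} (mu f)      = derive (# 20) (n ∷ gn f ∷ []) refl (dec-complete f ∷ [])

      decs-complete : ∀ {n m} (cs : Vec (Code n) m) → Der (decs n m (gnV cs))
      decs-complete {n} []               = derive (# 21) (n ∷ []) refl []
      decs-complete {n} {suc m} (c ∷ cs) = derive (# 22) (n ∷ m ∷ gn c ∷ gnV cs ∷ []) refl
        (dec-complete c ∷ decs-complete cs ∷ [])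

    nth-complete : ∀ {n} (xs : Vec ℕ n) i → Der (nth (encV xs) (toℕ i) (lookup xs i))
    nth-complete (x ∷ xs) zero    = derive (# 12) (x ∷ encV xs ∷ []) refl []
    nth-complete (x ∷ xs) (suc i) = derive (# 13) (x ∷ encV xs ∷ toℕ i ∷ lookup xs i ∷ []) refl (nth-complete xs i ∷ [])

    mem-complete : ∀ {σ n v} → At σ n v → Der (mem (encS σ) (pr n v))
    mem-complete {v ∷ σ} here        = derive (# 23) (pr (length σ) v ∷ encS σ ∷ []) refl []
    mem-complete {u ∷ σ} {n} {v} (there p) =
      derive (# 24) (pr (length σ) u ∷ encS σ ∷ pr n v ∷ []) refl (mem-complete p ∷ [])

    orcl-direct : ∀ x → Der (orcl 0 x (χ Z x))
    orcl-direct x = derive (# 25) (x ∷ χ Z x ∷ []) (dist-refl (χ Z x)) []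

    orcl-left : ∀ τ x → Der (orcl (suc τ) (2 * x) (χ Z x))
    orcl-left τ x = derive (# 26) (τ ∷ x ∷ χ Z x ∷ []) (dist-refl (χ Z x)) []

    orcl-right : ∀ {τ x u} → At τ (fst x) u → Der (orcl (suc (encS τ)) (suc (2 * x)) (graphBit u x))
    orcl-right {τ} {x} {u} at = derive (# 27) (encS τ ∷ x ∷ graphBit u x ∷ u ∷ []) (dist-refl (graphBit u x))
      (mem-complete at ∷ [])

    mutual
      big-complete : ∀ {k e x i σ} → Big k (λ τ → DerEv τ e x i) σ →
        Der (big k (encS σ) (length σ) (pr e (pr x i)))
      big-complete {k} {e} {x} {i} {σ} (leaf d) =
        derive (# 28) (k ∷ encS σ ∷ length σ ∷ e ∷ x ∷ i ∷ []) refl (d ∷ [])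
      big-complete {k} {e} {x} {i} {σ} (node b) =
        derive (# 29) (k ∷ encS σ ∷ length σ ∷ pr e (pr x i) ∷ []) refl (bigN-complete b ∷ [])

      bigN-complete : ∀ {k e x i j b σ} → BigN k (λ τ → DerEv τ e x i) j b σ →
        Der (bigN k j b (encS σ) (length σ) (pr e (pr x i)))
      bigN-complete {k} {e} {x} {i} {_} {b} {σ} none =
        derive (# 30) (k ∷ b ∷ encS σ ∷ length σ ∷ pr e (pr x i) ∷ []) refl []
      bigN-complete {k} {e} {x} {i} {suc j} {b} {σ} (some n b≤n d r) =
        derive (# 31) (k ∷ j ∷ b ∷ encS σ ∷ length σ ∷ pr e (pr x i) ∷ n ∷ []) (m≤n⇒m∸n≡0 b≤n)
          (big-complete d ∷ bigN-complete r ∷ [])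

    ext-complete : ∀ {τ σ} → τ ≽ σ → Der (ext (encS τ) (length τ) (encS σ) (length σ))
    ext-complete {τ} done = derive (# 32) (encS τ ∷ length τ ∷ []) refl []
    ext-complete {n ∷ τ} {σ} (more p) =
      derive (# 33) (encS τ ∷ length τ ∷ n ∷ encS σ ∷ length σ ∷ []) refl (ext-complete p ∷ [])

    haltExt-complete : ∀ {τ σ e y} → τ ≽ σ → DerEv τ e e y →
      Der (haltExt (pr (encS σ) (length σ)) e (pr (encS τ) (length τ)))
    haltExt-complete {τ} {σ} {e} {y} τ≽σ d =
      derive (# 34) (encS σ ∷ length σ ∷ e ∷ encS τ ∷ length τ ∷ y ∷ []) refl (ext-complete τ≽σ ∷ d ∷ [])

    module _ (X : SetN) (P : ℕ → ℕ) (oracle : ∀ x → Eventually λ t → Der (orcl (P t) x (χ X x))) where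
      mutual
        -- A halting computation asks finitely many oracle questions, each answered from some stage
        -- on; the maximum of these stages works. A constant `P` covers a fixed oracle.
        ev-complete : ∀ {n} {c : Code n} {xs y} → Eval X c xs y →
          Eventually λ t → Der (ev (P t) n (gn c) (encV xs) y)
        ev-complete {n} {xs = xs} ev-zer = always λ t → derive (# 0) (P t ∷ n ∷ encV xs ∷ []) refl []
        ev-complete (ev-succ {x}) = always λ t → derive (# 1) (P t ∷ x ∷ []) refl []
        ev-complete {n} (ev-proj i {xs}) = always λ t →
          derive (# 2) (P t ∷ n ∷ toℕ i ∷ encV xs ∷ lookup xs i ∷ []) (m≤n⇒m∸n≡0 (toℕ<n i)) (nth-complete xs i ∷ [])
        ev-complete (ev-orc1 {x} p) = eventually-map
          (λ t d → derive (# 3) (P t ∷ x ∷ 1 ∷ []) refl (subst (λ b → Der (orcl (P t) x b)) (χ-true p) d ∷ [])) (oracle x)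
        ev-complete (ev-orc0 {x} ¬p) = eventually-map
          (λ t d → derive (# 3) (P t ∷ x ∷ 0 ∷ []) refl (subst (λ b → Der (orcl (P t) x b)) (χ-false ¬p) d ∷ [])) (oracle x)
        ev-complete {n} (ev-comp {m} {f = f} {gs} {xs} {ys} {z} ps p) = eventually-both
          (λ t ds d → derive (# 4) (P t ∷ n ∷ m ∷ gn f ∷ gnV gs ∷ encV xs ∷ z ∷ encV ys ∷ []) refl (ds ∷ d ∷ []))
          (evV-complete ps) (ev-complete p)
        ev-complete (ev-prec0 {n} {f} {g} {xs} {z} p) = eventually-map
          (λ t d → derive (# 5) (P t ∷ n ∷ gn f ∷ gn g ∷ encV xs ∷ z ∷ []) refl (d ∷ dec-complete g ∷ []))
          (ev-complete p)
        ev-complete (ev-precS {n} {f} {g} {xs} {k} {w} {z} p q) = eventually-both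
          (λ t d d' → derive (# 6) (P t ∷ n ∷ gn f ∷ gn g ∷ k ∷ encV xs ∷ z ∷ w ∷ []) refl
            (d ∷ d' ∷ dec-complete f ∷ []))
          (ev-complete p) (ev-complete q)
        ev-complete {n} (ev-mu {f = f} {xs} {k} p ps) = eventually-both
          (λ t d d' → derive (# 7) (P t ∷ n ∷ gn f ∷ encV xs ∷ k ∷ []) refl (d ∷ d' ∷ []))
          (ev-complete p) (below-complete {xs = xs} k λ j j<k → proj₁ (ps j j<k) , ev-complete (proj₂ (ps j j<k)))

        evV-complete : ∀ {n m} {cs : Vec (Code n) m} {xs ys} → EvalV X xs cs ys →
          Eventually λ t → Der (evV (P t) n m (gnV cs) (encV xs) (encV ys))
        evV-complete {n} {xs = xs} evv-[] = always λ t → derive (# 8) (P t ∷ n ∷ encV xs ∷ []) refl []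
        evV-complete {n} {suc m} {xs = xs} (evv-∷ {g = g} {gs} {y} {ys} p ps) = eventually-both
          (λ t d ds → derive (# 9) (P t ∷ n ∷ m ∷ gn g ∷ gnV gs ∷ encV xs ∷ y ∷ encV ys ∷ []) refl (d ∷ ds ∷ []))
          (ev-complete p) (evV-complete ps)

        below-complete : ∀ {n} {f : Code (suc n)} {xs} k →
          (∀ j → j < k → Σ ℕ λ v → Eventually λ t → Der (ev (P t) (suc n) (gn f) (pr j (encV xs)) (suc v))) →
          Eventually λ t → Der (below (P t) n (gn f) k (encV xs))
        below-complete {n} {f} {xs} zero h = always λ t → derive (# 10) (P t ∷ n ∷ gn f ∷ encV xs ∷ []) refl []
        below-complete {n} {f} {xs} (suc k) h = eventually-both
          (λ t d d' → derive (# 11) (P t ∷ n ∷ gn f ∷ k ∷ encV xs ∷ proj₁ (h k ≤-refl) ∷ []) refl (d ∷ d' ∷ []))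
          (below-complete {xs = xs} k λ j j<k → h j (m≤n⇒m≤1+n j<k)) (proj₂ (h k ≤-refl))

  -- Jumps and joins

  ≤T-refl : ∀ {A} → A ≤T A
  ≤T-refl = χFn

  ≤T-via : ∀ {A B} {t : ℕ → ℕ} → Fn₁ B t → (∀ x → χ A x ≡ χ B (t x)) → A ≤T B
  ≤T-via F eq = Fn₁-cong (λ x → sym (eq x)) (fn (ap1 χFn (ap1 F v0)))

  ⊕-left : ∀ {A B} x → (A ⊕ B) (2 * x) → A x
  ⊕-left {A} x (inj₁ (n , eq , a)) = subst A (sym (*-cancelˡ-≡ x n 2 eq)) a
  ⊕-left x (inj₂ (n , eq , _)) = ⊥-elim (even≢odd x n eq)

  ⊕-right : ∀ {A B} x → (A ⊕ B) (suc (2 * x)) → B x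
  ⊕-right x (inj₁ (n , eq , _)) = ⊥-elim (even≢odd n x (sym eq))
  ⊕-right {B = B} x (inj₂ (n , eq , b)) = subst B (sym (*-cancelˡ-≡ x n 2 (suc-injective eq))) b

  χ-⊕-left : ∀ {A B} x → χ (A ⊕ B) (2 * x) ≡ χ A x
  χ-⊕-left x = χ-cong (⊕-left x) λ a → inj₁ (x , refl , a)

  χ-⊕-right : ∀ {A B} x → χ (A ⊕ B) (suc (2 * x)) ≡ χ B x
  χ-⊕-right x = χ-cong (⊕-right x) λ b → inj₂ (x , refl , b)

  ≤T-left : ∀ {A B} → A ≤T A ⊕ B
  ≤T-left = ≤T-via (Fn₁-cong (λ _ → refl) (fn (ap2 mulFn (con 2) v0))) λ x → sym (χ-⊕-left x)

  ≤T-right : ∀ {A B} → B ≤T A ⊕ B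
  ≤T-right = ≤T-via (Fn₁-cong (λ _ → refl) (fn (ap1 sucFn (ap2 mulFn (con 2) v0)))) λ x → sym (χ-⊕-right x)

  ⊕-lub : ∀ {A B C} → A ≤T C → B ≤T C → A ⊕ B ≤T C
  ⊕-lub {A} {B} F G = Fn₁-cong eq (fn (if0 (ap1 oddFn v0) (ap1 F (ap1 halfFn v0)) (ap1 G (ap1 halfFn v0))))
    where
    eq : ∀ x → ifz (odd x) (χ A (half x)) (χ B (half x)) ≡ χ (A ⊕ B) x
    eq x with even-or-odd x
    ... | inj₁ (n , refl) rewrite odd-double n | half-even n = sym (χ-⊕-left n)
    ... | inj₂ (n , refl) rewrite half-odd n | odd-double n = sym (χ-⊕-right n)

  -- The parameter theorem for searches: the program ignores its input and looks for a zero of `v`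
  -- with `p` built in as a constant. Hence membership of its number in the jump is exactly the
  -- question whether a zero exists.
  index : Code 2 → ℕ → ℕ
  index v p = gn {1} (comp (mu v) (constCode p ∷ []))

  indexFn : ∀ {X} v → Fn₁ X (index v)
  indexFn {X} v = Fn₁-cong (λ _ → refl)
    (fn (con 4 & con 1 & con (gn (mu v)) & ap1 constFn v0 & con 0))
    where
    eq : ∀ p → natrec _ _ (p ∷ []) ≡ gn {1} (constCode p)
    eq zero    = refl
    eq (suc p) = cong (λ w → pr 4 (pr 1 (pr (pr 1 0) (pr w 0)))) (eq p)

    constFn : Fn₁ X (λ p → gn {1} (constCode p))
    constFn = Fn₁-cong eq (precFn (fn (con (pr 0 0))) (fn (con 4 & con 1 & (con 1 & con 0) & v1 & con 0)))

  module _ {X : SetN} {f : ℕ → ℕ → ℕ} (F : Fn₂ X f) where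
    index-halts : ∀ p w → f w p ≡ 0 → jump X (index (proj₁ F) p)
    index-halts p w fwp≡0 with least (λ w → f w p) w fwp≡0
    ... | k , fk≡0 , below = k , Eval→Φ (comp (mu (proj₁ F)) (constCode p ∷ [])) (ev-comp (evv-∷ (constCode-correct p _) evv-[])
      (ev-mu (subst (Eval X (proj₁ F) (k ∷ p ∷ [])) fk≡0 (proj₂ F _))
        λ j j<k → proj₁ (below j j<k) , subst (Eval X (proj₁ F) (j ∷ p ∷ [])) (proj₂ (below j j<k)) (proj₂ F _)))

    halts-index : ∀ p → jump X (index (proj₁ F) p) → ∃ λ w → f w p ≡ 0
    halts-index p (y , φ) with Φ→Eval φ
    ... | c , eq , e with gn-injective c (comp (mu (proj₁ F)) (constCode p ∷ [])) eq
    halts-index p (y , φ) | _ , _ , ev-comp (evv-∷ q evv-[]) (ev-mu r _) | refl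
      with Eval-functional q (constCode-correct p _)
    ... | refl = y , Eval-functional (proj₂ F _) r

  -- The function searched is constant in the unknown, so the search stops at once or never.
  ≤T-jump : ∀ {X} → X ≤T jump X
  ≤T-jump {X} = ≤T-via (indexFn (proj₁ F)) λ p → χ-cong
    (λ x → index-halts F p 0 (cong (1 ∸_) (χ-true x)))
    (λ h → χ≡1 (1∸b≡0 (proj₂ (halts-index F p h)) (χ-bit p)))
    where
    F : Fn₂ X (λ _ p → 1 ∸ χ X p)
    F = Fn₂-cong (λ _ _ → refl) (fn (ap2 monusFn (con 1) (ap1 χFn v1)))

    χ-bit : ∀ p → χ X p ≤ 1
    χ-bit p with em {X p}
    ... | yes _ = s≤s z≤n
    ... | no _  = z≤n

    1∸b≡0 : ∀ {b} → 1 ∸ b ≡ 0 → b ≤ 1 → b ≡ 1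
    1∸b≡0 eq b≤1 = ≤-antisym b≤1 (m∸n≡0⇒m≤n eq)

  -- Searching for derivations; monotonicity of the jump

  module Search (Z : SetN) where
    open System Z

    -- In γ, variable 0 is the unknown and variable 1 the parameter p; w codes a value of the unknown
    -- and a derivation.
    search : Vec (Tm Z 2) 7 → ℕ → ℕ → ℕ
    search γ w p = check (snd w) (encV (⟦ γ ⟧* (fst w ∷ p ∷ [])))

    searchFn : ∀ γ → Fn₂ Z (search γ)
    searchFn γ = Fn₂-cong (λ w p → cong (check (snd w)) (encTm-correct γ (fst w ∷ p ∷ [])))
      (fn (ap2 checkFn (ap1 sndFn v0) (app ⟦ encTm γ ⟧ (fn (encTm γ)) (ap1 fstFn v0 ∷ v1 ∷ []))))

    search-complete : ∀ γ y p → Der (⟦ γ ⟧* (y ∷ p ∷ [])) → ∃ λ w → fst w ≡ y × search γ w p ≡ 0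
    search-complete γ y p d with Der→check (⟦ γ ⟧* (y ∷ p ∷ [])) d
    ... | w , eq = pr y w , fst-pr y w ,
      trans (cong₂ (λ w' y' → check w' (encV (⟦ γ ⟧* (y' ∷ p ∷ [])))) (snd-pr y w) (fst-pr y w)) eq

    search-sound : ∀ γ w p → search γ w p ≡ 0 → Der (⟦ γ ⟧* (fst w ∷ p ∷ []))
    search-sound γ w p eq = check→Der (⟦ γ ⟧* (fst w ∷ p ∷ [])) (snd w) eq

  module _ (A : SetN) where
    open System A
    open Search A
    open Completeness A using (ev-complete; orcl-direct)
    open Meaning A (_≡ 0) using (meaning)

    haltGoal : Vec (Tm A 2) 7
    haltGoal = T.ev (con 0) (con 1) v1 (v1 & con 0) v0

    halts→search : ∀ e → jump A e → ∃ λ w → search haltGoal w e ≡ 0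
    halts→search e (y , φ) with Φ→Eval φ
    ... | c , refl , ev with ev-complete A (λ _ → 0) (λ x → always λ _ → orcl-direct x) ev
    ...   | s , d with search-complete haltGoal y (gn c) (d s ≤-refl)
    ...     | w , _ , eq = w , eq

    search→halts : ∀ e w → search haltGoal w e ≡ 0 → jump A e
    search→halts e w eq
      with meaning ((λ _ _ → refl) , (λ _ _ ()) , (λ _ _ _ ())) (search-sound haltGoal w e eq) refl (e ∷ []) refl
    ... | c , refl , ev = fst w , Eval→Φ c ev

  -- Halting relative to `A` means that the derivation search has a zero; that search is computable
  -- from `A`, hence from `B`, so the question is one about `jump B`.
  jump-mono : ∀ {A B} → A ≤T B → jump A ≤T jump B
  jump-mono {A} {B} A≤B = ≤T-via (indexFn (proj₁ F)) λ e → χ-cong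
    (λ h → let w , eq = halts→search A e h in index-halts F e w eq)
    (λ h → let w , eq = halts-index F e h in search→halts A e w eq)
    where
    F : Fn₂ B (Search.search A (haltGoal A))
    F = Fn-mono A≤B (Search.searchFn A (haltGoal A))

  jumpⁿ-mono : ∀ m {A B} → A ≤T B → jumpⁿ m A ≤T jumpⁿ m B
  jumpⁿ-mono zero    A≤B = A≤B
  jumpⁿ-mono (suc m) A≤B = jump-mono (jumpⁿ-mono m A≤B)

  jumpⁿ-jump : ∀ m A → jumpⁿ m (jump A) ≡ jumpⁿ (suc m) A
  jumpⁿ-jump zero    A = refl
  jumpⁿ-jump (suc m) A = cong jump (jumpⁿ-jump m A)

  -- Limits of strings

  At-< : ∀ {σ n v} → At σ n v → n < length σ
  At-< here      = ≤-refl
  At-< (there p) = m≤n⇒m≤1+n (At-< p)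

  At-functional : ∀ {σ n u v} → At σ n u → At σ n v → u ≡ v
  At-functional here      here      = refl
  At-functional here      (there q) = ⊥-elim (<-irrefl refl (At-< q))
  At-functional (there p) here      = ⊥-elim (<-irrefl refl (At-< p))
  At-functional (there p) (there q) = At-functional p q

  At-total : ∀ σ {n} → n < length σ → ∃ λ v → At σ n v
  At-total (v ∷ σ) n< with m≤n⇒m<n∨m≡n (s≤s⁻¹ n<)
  ... | inj₁ n<' = let u , p = At-total σ n<' in u , there p
  ... | inj₂ refl = v , here

  At-mono : ∀ {τ σ n v} → τ ≽ σ → At σ n v → At τ n v
  At-mono done     p = p
  At-mono (more q) p = there (At-mono q p)

  graph : (ℕ → ℕ) → SetN
  graph f x = f (fst x) ≡ snd x

  χ-graph : ∀ f x → χ (graph f) x ≡ graphBit (f (fst x)) x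
  χ-graph f x with dist (f (fst x)) (snd x) in eq
  ... | zero  = χ-true (dist≡0 (f (fst x)) (snd x) eq)
  ... | suc d = χ-false λ p → 0≢1+n (trans (sym (trans (cong (dist (f (fst x))) (sym p)) (dist-refl (f (fst x))))) eq)

  graph-pr : ∀ f n → graph f (pr n (f n))
  graph-pr f n = trans (cong f (fst-pr n (f n))) (sym (snd-pr n (f n)))

  graphFn : ∀ f → Fn₁ (graph f) f
  graphFn f = Fn₁-cong eq (proj₁ (proj₂ search))
    where
    search : Σ (Vec ℕ 1 → ℕ) λ g → Fn (graph f) 1 g × (∀ xs → 1 ∸ χ (graph f) (pr (lookup xs zero) (g xs)) ≡ 0)
    search = muFn (fn (ap2 monusFn (con 1) (ap1 χFn (ap2 prFn v1 v0))))
      λ { (n ∷ []) → f n , cong (1 ∸_) (χ-true (graph-pr f n)) }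

    eq : ∀ n → proj₁ search (n ∷ []) ≡ f n
    eq n with em {graph f (pr n (proj₁ search (n ∷ [])))}
    ... | yes p = sym (trans (cong f (sym (fst-pr n _))) (trans p (snd-pr n _)))
    ... | no ¬p = ⊥-elim (0≢1+n (trans (sym (proj₂ (proj₂ search) (n ∷ []))) (cong (1 ∸_) (χ-false ¬p))))

  module Limit (sig : ℕ → String) (sig-≽ : ∀ s → sig (suc s) ≽ sig s)
               (sig-< : ∀ s → length (sig s) < length (sig (suc s))) where
    ≤-length : ∀ s → s ≤ length (sig s)
    ≤-length zero    = z≤n
    ≤-length (suc s) = ≤-trans (s≤s (≤-length s)) (sig-< s)

    sig-mono : ∀ {s t} → s ≤ t → sig t ≽ sig s
    sig-mono {s} {t} s≤t = subst (λ t → sig t ≽ sig s) (m∸n+n≡m s≤t) (go (t ∸ s))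
      where
      go : ∀ d → sig (d + s) ≽ sig s
      go zero    = done
      go (suc d) = ≽-trans (sig-≽ (d + s)) (go d)

    letter : ∀ n → ∃ λ v → At (sig (suc n)) n v
    letter n = At-total (sig (suc n)) (≤-length (suc n))

    limit : ℕ → ℕ
    limit n = proj₁ (letter n)

    limit-eventually : ∀ n → Eventually λ t → At (sig t) n (limit n)
    limit-eventually n = suc n , λ t n<t → At-mono (sig-mono n<t) (proj₂ (letter n))

    Prefix : String → Set
    Prefix τ = ∀ n v → At τ n v → limit n ≡ v

    sig-prefix : ∀ s → Prefix (sig s)
    sig-prefix s n v p with limit-eventually n
    ... | t , q = At-functional (q (s ⊔ t) (m≤n⊔m s t)) (At-mono (sig-mono (m≤m⊔n s t)) p)

    prefix-≽ : ∀ {τ σ} → τ ≽ σ → Prefix τ → Prefix σ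
    prefix-≽ τ≽σ p n v at = p n v (At-mono τ≽σ at)

    module _ (Z : SetN) where
      open System Z
      open Completeness Z

      oracle-eventually : ∀ x → Eventually λ t → Der (G.orcl (suc (encS (sig t))) x (χ (Z ⊕ graph limit) x))
      oracle-eventually x with even-or-odd x
      ... | inj₁ (n , refl) = always λ t →
        subst (λ b → Der (G.orcl (suc (encS (sig t))) (2 * n) b)) (sym (χ-⊕-left n)) (orcl-left (encS (sig t)) n)
      ... | inj₂ (n , refl) = eventually-map (λ t at →
        subst (λ b → Der (G.orcl (suc (encS (sig t))) (suc (2 * n)) b))
          (sym (trans (χ-⊕-right n) (χ-graph limit n))) (orcl-right {x = n} at))
        (limit-eventually (fst n))

      DerEv-complete : ∀ {e x y} → Φ (Z ⊕ graph limit) e x y → Eventually λ t → DerEv (sig t) e x y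
      DerEv-complete φ with Φ→Eval φ
      ... | c , refl , ev = ev-complete (Z ⊕ graph limit) (λ t → suc (encS (sig t))) oracle-eventually ev

      -- Goals are read for the oracle `Z ⊕ graph limit`, with the codes of prefixes of the limit as
      -- the compatible ones.
      DerEv-sound : ∀ {τ e x y} → Prefix τ → DerEv τ e x y → Φ (Z ⊕ graph limit) e x y
      DerEv-sound {τ} {e} {x} {y} prefix d with meaning oracle d (τ , refl , prefix) (x ∷ []) refl
        where
        open Meaning (Z ⊕ graph limit) (λ π → Σ String λ τ → π ≡ suc (encS τ) × Prefix τ)

        oracle : OracleSound
        oracle = (λ { x (_ , () , _) }) , (λ τ x _ → χ-⊕-left x) , right
          where
          right : ∀ τ x u → (Σ String λ σ → suc τ ≡ suc (encS σ) × Prefix σ) → I (G.mem τ (pr (fst x) u)) →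
            χ (Z ⊕ graph limit) (suc (2 * x)) ≡ graphBit u x
          right _ x u (σ , refl , prefix) ih with ih σ refl
          ... | n , v , eq , at with pr-injective eq
          ...   | refl , refl = trans (χ-⊕-right x) (trans (χ-graph limit x) (cong (λ u → graphBit u x) (prefix _ _ at)))
      ... | c , refl , ev = Eval→Φ c ev

  -- Jump inversion

  ≽-length : ∀ {τ σ} → τ ≽ σ → length σ ≤ length τ
  ≽-length done     = ≤-refl
  ≽-length (more p) = m≤n⇒m≤1+n (≽-length p)

  χ-suc : ∀ {X x k} → χ X x ≡ suc k → X x
  χ-suc {X} {x} eq with em {X x}
  ... | yes p = p
  χ-suc () | no _

  num : String → ℕ
  num σ = pr (encS σ) (length σ)

  snoc : ℕ → ℕ → ℕ
  snoc q v = pr (pr (pr (snd q) v) (fst q)) (suc (snd q))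

  snoc-num : ∀ τ v → snoc (num τ) v ≡ num (v ∷ τ)
  snoc-num τ v rewrite fst-pr (encS τ) (length τ) | snd-pr (encS τ) (length τ) = refl

  snocFn : ∀ {X} → Fn₂ X snoc
  snocFn = Fn₂-cong (λ _ _ → refl) (fn (((ap1 sndFn v0 & v1) & ap1 fstFn v0) & ap1 sucFn (ap1 sndFn v0)))

  -- Friedberg's construction: at stage s the string is extended so as to decide whether s enters
  -- the jump, and then the bit H(s) is appended.
  module JumpInversion (Z H : SetN) (Z'≤H : jump Z ≤T H) where
    open System Z
    open Completeness Z using (haltExt-complete)
    open Search Z

    extGoal : Vec (Tm Z 2) 7
    extGoal = T.haltExt (ap1 fstFn v1) (ap1 sndFn v1) v0

    opaque
      question : ℕ → ℕ
      question = index (proj₁ (searchFn extGoal))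

      questionFn : ∀ {X} → Fn₁ X question
      questionFn = indexFn (proj₁ (searchFn extGoal))

      question-intro : ∀ p w → search extGoal w p ≡ 0 → jump Z (question p)
      question-intro = index-halts (searchFn extGoal)

      question-elim : ∀ p → jump Z (question p) → ∃ λ w → search extGoal w p ≡ 0
      question-elim = halts-index (searchFn extGoal)

    ask : ℕ → ℕ
    ask p = χ (jump Z) (question p)

    askFn : Fn₁ (jump Z) ask
    askFn = Fn₁-cong (λ _ → refl) (fn (ap1 χFn (ap1 questionFn v0)))

    -- A negative answer makes the function vanish, so minimisation always stops.
    guarded : ℕ → ℕ → ℕ
    guarded w p = ifz (ask p) 0 (search extGoal w p)

    guardedFn : Fn₂ (jump Z) guarded
    guardedFn = Fn₂-cong (λ _ _ → refl)
      (fn (if0 (ap1 askFn v1) (con 0) (ap2 (Fn-mono ≤T-jump (searchFn extGoal)) v0 v1)))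

    guarded-total : ∀ p → ∃ λ w → guarded w p ≡ 0
    guarded-total p = go (ask p) refl
      where
      go : ∀ a → ask p ≡ a → ∃ λ w → ifz a 0 (search extGoal w p) ≡ 0
      go zero    _  = 0 , refl
      go (suc _) eq = question-elim p (χ-suc eq)

    opaque
      found : Σ (Vec ℕ 1 → ℕ) λ g → Fn (jump Z) 1 g × (∀ xs → un2 guarded (g xs ∷ xs) ≡ 0)
      found = muFn guardedFn λ { (p ∷ []) → guarded-total p }

    witness : ℕ → ℕ
    witness p = proj₁ found (p ∷ [])

    next : ℕ → ℕ
    next p = ifz (ask p) (fst p) (fst (witness p))

    nextFn : Fn₁ (jump Z) next
    nextFn = Fn₁-cong (λ _ → refl)
      (fn (if0 (ap1 askFn v0) (ap1 fstFn v0) (ap1 fstFn (app (proj₁ found) (proj₁ (proj₂ found)) (v0 ∷ [])))))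

    extGoal-Der : ∀ q r e → Der (⟦ extGoal ⟧* (q ∷ pr r e ∷ [])) ≡ Der (G.haltExt r e q)
    extGoal-Der q r e rewrite fst-pr r e | snd-pr r e = refl

    extGoal-sound : ∀ {σ q e} → Der (G.haltExt (num σ) e q) →
      Σ String λ τ → q ≡ num τ × τ ≽ σ × ∃ λ y → DerEv τ e e y
    extGoal-sound {σ} d = meaning ((λ _ ()) , (λ _ _ ()) , (λ _ _ _ ())) d σ refl
      -- With no compatible code the oracle conditions are vacuous; the meaning of `haltExt` itself
      -- speaks only of derivability.
      where open Meaning Z (λ _ → ⊥)

    next-spec : ∀ σ e → Σ String λ τ → next (pr (num σ) e) ≡ num τ × τ ≽ σ ×
      (jump Z (question (pr (num σ) e)) → ∃ λ y → DerEv τ e e y)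
    next-spec σ e = go (ask p) refl
      where
      p w : ℕ
      p = pr (num σ) e
      w = witness p

      go : ∀ a → ask p ≡ a → Σ String λ τ → next p ≡ num τ × τ ≽ σ ×
        (jump Z (question p) → ∃ λ y → DerEv τ e e y)
      go zero eq = σ , trans (cong (λ a → ifz a (fst p) (fst w)) eq) (fst-pr (num σ) e) , done
        , λ h → ⊥-elim (χ≡0 eq h)
      go (suc _) eq
        with extGoal-sound {σ} (subst (λ D → D) (extGoal-Der (fst w) (num σ) e)
               (search-sound extGoal w p (subst (λ a → ifz a 0 (search extGoal w p) ≡ 0) eq (proj₂ (proj₂ found) (p ∷ [])))))
      ... | τ , eq' , τ≽σ , d = τ , trans (cong (λ a → ifz a (fst p) (fst w)) eq) eq' , τ≽σ , λ _ → d

    next-complete : ∀ {σ τ e y} → τ ≽ σ → DerEv τ e e y → jump Z (question (pr (num σ) e))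
    next-complete {σ} {τ} {e} τ≽σ d
      with search-complete extGoal (num τ) (pr (num σ) e)
             (subst (λ D → D) (sym (extGoal-Der (num τ) (num σ) e)) (haltExt-complete τ≽σ d))
    ... | w , _ , eq = question-intro (pr (num σ) e) w eq

    hat : String → ℕ → String
    hat σ e = proj₁ (next-spec σ e)

    sig : ℕ → String
    sig zero    = []
    sig (suc s) = χ H s ∷ hat (sig s) s

    hat-≽ : ∀ s → hat (sig s) s ≽ sig s
    hat-≽ s = proj₁ (proj₂ (proj₂ (next-spec (sig s) s)))

    open Limit sig (λ s → more (hat-≽ s)) (λ s → s≤s (≽-length (hat-≽ s)))

    stage : ℕ → ℕ
    stage s = pr (num (sig s)) s

    -- The construction can be retraced by any `Y` above `jump Z` that recovers the coded bits: `H`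
    -- knows them, and `jump G∞` reads them off the limit. For the latter, `bit` also sees the
    -- extension just chosen.
    stageFn : ∀ {Y bit} → jump Z ≤T Y → Fn₂ Y bit → (∀ s → bit (next (stage s)) s ≡ χ H s) → Fn₁ Y stage
    stageFn {Y} {bit} Z'≤Y bitFn bit-correct = Fn₁-cong (λ s → cong (λ q → pr q s) (eq s))
      (fn (app (natrec _ _) rec (v0 ∷ []) & v0))
      where
      step' : Tm Y 2
      step' = ap2 snocFn (ap1 (Fn-mono Z'≤Y nextFn) (v1 & v0)) (ap2 bitFn (ap1 (Fn-mono Z'≤Y nextFn) (v1 & v0)) v0)

      rec : Fn Y 1 (natrec (λ _ → num []) ⟦ step' ⟧)
      rec = precFn (fn (con (num []))) (fn step')

      eq : ∀ s → natrec (λ _ → num []) ⟦ step' ⟧ (s ∷ []) ≡ num (sig s)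
      eq zero    = refl
      eq (suc s) = trans (cong (λ q → snoc (next (pr q s)) (bit (next (pr q s)) s)) (eq s))
        (trans (cong₂ snoc (proj₁ (proj₂ (next-spec (sig s) s))) (bit-correct s)) (snoc-num (hat (sig s) s) (χ H s)))

    G∞ : SetN
    G∞ = Z ⊕ graph limit

    -- A halting computation is derivable from a late string of the sequence, which extends `sig e`,
    -- so the answer at stage `e` was positive. Conversely, the extension chosen after a positive
    -- answer is a prefix of the limit.
    jump-G∞ : ∀ e → χ (jump G∞) e ≡ ask (stage e)
    jump-G∞ e = χ-cong to from
      where
      to : jump G∞ e → jump Z (question (stage e))
      to (y , φ) with DerEv-complete Z φ
      ... | t , d = next-complete (sig-mono (m≤n⊔m t e)) (d (t ⊔ e) (m≤m⊔n t e))

      from : jump Z (question (stage e)) → jump G∞ e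
      from h with proj₂ (proj₂ (proj₂ (next-spec (sig e) e))) h
      ... | y , d = y , DerEv-sound Z (prefix-≽ (more done) (sig-prefix (suc e))) d

    jump-G∞≤H : jump G∞ ≤T H
    jump-G∞≤H = Fn₁-cong (λ e → sym (jump-G∞ e)) (fn (ap1 (Fn-mono Z'≤H askFn)
      (ap1 (stageFn Z'≤H (Fn₂-cong (λ _ _ → refl) (fn (ap1 χFn v1))) (λ _ → refl)) v0)))

    -- The bit follows directly after the chosen extension, so its position is the length of that
    -- extension.
    coded-bit : ∀ s → limit (snd (next (stage s))) ≡ χ H s
    coded-bit s = trans
      (cong limit (trans (cong snd (proj₁ (proj₂ (next-spec (sig s) s)))) (snd-pr _ (length (hat (sig s) s)))))
      (sig-prefix (suc s) _ _ here)

    H≤jump-G∞ : H ≤T jump G∞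
    H≤jump-G∞ = Fn₁-cong coded-bit (fn (ap1 limitFn (ap1 sndFn (ap1 (Fn-mono Z'≤ nextFn)
      (ap1 (stageFn Z'≤ (Fn₂-cong (λ _ _ → refl) (fn (ap1 limitFn (ap1 sndFn v0)))) coded-bit) v0)))))
      where
      Z'≤ : jump Z ≤T jump G∞
      Z'≤ = jump-mono ≤T-left

      limitFn : Fn₁ (jump G∞) limit
      limitFn = Fn-mono (≤T-trans (≤T-right {Z}) ≤T-jump) (graphFn limit)

  opaque
    jump-inversion : ∀ Z H → jump Z ≤T H → Σ SetN λ G → Z ≤T G × jump G ≤T H × H ≤T jump G
    jump-inversion Z H Z'≤H = G∞ , ≤T-left , jump-G∞≤H , H≤jump-G∞
      where open JumpInversion Z H Z'≤H

  -- Induction over the base: `jump Z` is inverted `m` times to give `H`, and one more inversion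
  -- over `Z` turns `H` into the jump of `G`, up to Turing equivalence.
  jumpⁿ-inversion : ∀ m Z A → Σ SetN λ G → Z ≤T G × jumpⁿ m G ≤T jumpⁿ m Z ⊕ A × A ≤T jumpⁿ m G
  jumpⁿ-inversion zero    Z A = Z ⊕ A , ≤T-left , ≤T-refl , ≤T-right
  jumpⁿ-inversion (suc m) Z A with jumpⁿ-inversion m (jump Z) A
  ... | H , Z'≤H , Hᵐ≤ , A≤Hᵐ with jump-inversion Z H Z'≤H
  ...   | G , Z≤G , G'≤H , H≤G' = G , Z≤G
    , subst₂ (λ B C → B ≤T C ⊕ A) (jumpⁿ-jump m G) (jumpⁿ-jump m Z) (≤T-trans (jumpⁿ-mono m G'≤H) Hᵐ≤)
    , subst (A ≤T_) (jumpⁿ-jump m G) (≤T-trans A≤Hᵐ (jumpⁿ-mono m H≤G'))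

  -- Bushy tree forcing

  mutual
    Big-mono : ∀ {k C C' σ} → (∀ τ → C τ → C' τ) → Big k C σ → Big k C' σ
    Big-mono f (leaf c) = leaf (f _ c)
    Big-mono f (node b) = node (BigN-mono f b)

    BigN-mono : ∀ {k C C' j b σ} → (∀ τ → C τ → C' τ) → BigN k C j b σ → BigN k C' j b σ
    BigN-mono f none             = none
    BigN-mono f (some n b≤n d r) = some n b≤n (Big-mono f d) (BigN-mono f r)

  BigN-weaken : ∀ {k C j b b' σ} → b ≤ b' → BigN k C j b' σ → BigN k C j b σ
  BigN-weaken b≤b' none              = none
  BigN-weaken b≤b' (some n b'≤n d r) = some n (≤-trans b≤b' b'≤n) d r

  mutual
    -- Pigeonhole: each of the `k + l` children of a node is big for one of the two sets, so `k` of
    -- them fall to `B` or `l` to `C`.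
    Big-∪ : ∀ {k l B C σ} → Big (k + l) (λ τ → B τ ⊎ C τ) σ → Big k B σ ⊎ Big l C σ
    Big-∪ (leaf (inj₁ b)) = inj₁ (leaf b)
    Big-∪ (leaf (inj₂ c)) = inj₂ (leaf c)
    Big-∪ {k} {l} (node b) with BigN-∪ k l refl b
    ... | inj₁ b' = inj₁ (node b')
    ... | inj₂ c' = inj₂ (node c')

    -- `p` and `q` count the children still missing on either side; each child inspected lowers one
    -- of them.
    BigN-∪ : ∀ {k l B C j b σ} p q → j ≡ p + q → BigN (k + l) (λ τ → B τ ⊎ C τ) j b σ →
             BigN k B p b σ ⊎ BigN l C q b σ
    BigN-∪ zero    q       _  _ = inj₁ none
    BigN-∪ (suc p) zero    _  _ = inj₂ none
    BigN-∪ (suc p) (suc q) eq (some n b≤n d r) with Big-∪ d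
    ... | inj₁ d' with BigN-∪ p (suc q) (suc-injective eq) r
    ...   | inj₁ r' = inj₁ (some n b≤n d' r')
    ...   | inj₂ r' = inj₂ (BigN-weaken (m≤n⇒m≤1+n b≤n) r')
    BigN-∪ (suc p) (suc q) eq (some n b≤n d r) | inj₂ d'
      with BigN-∪ (suc p) q (trans (suc-injective eq) (+-suc p q)) r
    ...   | inj₁ r' = inj₁ (BigN-weaken (m≤n⇒m≤1+n b≤n) r')
    ...   | inj₂ r' = inj₂ (some n b≤n d' r')

  Big-∅ : ∀ {k C σ} → (∀ τ → ¬ C τ) → ¬ Big (suc k) C σ
  Big-∅ ∅ (leaf c)              = ∅ _ c
  Big-∅ ∅ (node (some _ _ d _)) = Big-∅ ∅ d

  -- This is `k * n + 1`; the final 1 is for the empty union, which is 1-small by `Big-∅`.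
  unionSize : ℕ → ℕ → ℕ
  unionSize k zero    = 1
  unionSize k (suc n) = k + unionSize k n

  Big-⋃ : ∀ {k σ} (C : ℕ → String → Set) n → Big (unionSize k n) (λ τ → ∃ λ i → i < n × C i τ) σ →
          ∃ λ i → i < n × Big k (C i) σ
  Big-⋃ C zero    b = ⊥-elim (Big-∅ (λ { _ (_ , () , _) }) b)
  Big-⋃ C (suc n) b with Big-∪ {B = C n} (Big-mono last b)
    where
    last : ∀ τ → (∃ λ i → i < suc n × C i τ) → C n τ ⊎ (∃ λ i → i < n × C i τ)
    last τ (i , i<1+n , c) with m≤n⇒m<n∨m≡n (s≤s⁻¹ i<1+n)
    ... | inj₁ i<n  = inj₂ (i , i<n , c)
    ... | inj₂ refl = inj₁ c
  ... | inj₁ b' = n , ≤-refl , b'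
  ... | inj₂ b' with Big-⋃ C n b'
  ...   | i , i<n , d = i , m≤n⇒m≤1+n i<n , d

  ≽-tail : ∀ {τ n σ} → τ ≽ n ∷ σ → τ ≽ σ
  ≽-tail p = ≽-trans p (more done)

  mutual
    -- Otherwise `B` would be big above every leaf of the tree for `C`, and grafting those trees
    -- onto it would make `B` big above `σ`. The grafted tree is `k`-bushy because both sizes are
    -- the same.
    escape : ∀ {k B C σ} → Big k C σ → ¬ Big k B σ → Σ String λ τ → τ ≽ σ × C τ × ¬ Big k B τ
    escape (leaf c) small = _ , done , c , small
    escape (node b) small with escapeN b
    ... | inj₁ found = found
    ... | inj₂ b'    = ⊥-elim (small (node b'))

    escapeN : ∀ {k B C j b σ} → BigN k C j b σ → (Σ String λ τ → τ ≽ σ × C τ × ¬ Big k B τ) ⊎ BigN k B j b σ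
    escapeN none = inj₂ none
    escapeN {k} {B} {σ = σ} (some n b≤n d r) with em {Big k B (n ∷ σ)}
    ... | no small with escape d small
    ...   | τ , τ≽ , c , small' = inj₁ (τ , ≽-tail τ≽ , c , small')
    escapeN (some n b≤n d r) | yes d' with escapeN r
    ...   | inj₁ found = inj₁ found
    ...   | inj₂ r'    = inj₂ (some n b≤n d' r')

  -- If all children were big, the first `k` of them would form a node.
  small-child : ∀ {k B σ} → ¬ Big k B σ → ∃ λ n → ¬ Big k B (n ∷ σ)
  small-child {k} {B} {σ} small with em {∃ λ n → ¬ Big k B (n ∷ σ)}
  ... | yes found = found
  ... | no ¬found = ⊥-elim (small (node (all k 0)))
    where
    all : ∀ j b → BigN k B j b σ
    all zero    b = none
    all (suc j) b with em {Big k B (b ∷ σ)}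
    ... | yes d = some b ≤-refl d (all j (suc b))
    ... | no ¬d = ⊥-elim (¬found (b , ¬d))

  module Forcing (D Z : SetN) (Z-not-HDNC : ¬ HDNC pow2 D Z) where
    open System Z
    open Completeness Z using (big-complete)
    open Search Z

    Agrees : String → Set
    Agrees τ = ∃ λ n → ∃ λ v → At τ n v × Φ D n n v

    -- Two distinct children of `σ` cannot both end in Φ_n(n) for n the length of `σ`. So one of two
    -- agreeing children already agrees within `σ`.
    Agrees-2-small : ∀ {σ} → Big 2 Agrees σ → Agrees σ
    Agrees-2-small (leaf c) = c
    Agrees-2-small (node (some n _ d (some n' n<n' d' none))) with Agrees-2-small d | Agrees-2-small d'
    ... | m , v , there p , φ | _ = m , v , p , φ
    ... | _ | m , v , there p , φ = m , v , p , φ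
    ... | _ , _ , here , φ | _ , _ , here , φ' = ⊥-elim (<-irrefl (Φ-functional φ φ') n<n')

    -- The limit will extend the stem and avoid B.
    record Condition : Set₁ where
      constructor condition
      field
        stem  : String
        k     : ℕ
        B     : String → Set
        small : ¬ Big k B stem

    open Condition

    record _⊑_ (c' c : Condition) : Set where
      field
        stem-≽ : stem c' ≽ stem c
        B-⊆    : ∀ τ → B c τ → B c' τ

    open _⊑_

    ⊑-trans : ∀ {a b c} → a ⊑ b → b ⊑ c → a ⊑ c
    ⊑-trans p q = record { stem-≽ = ≽-trans (stem-≽ p) (stem-≽ q) ; B-⊆ = λ τ x → B-⊆ p τ (B-⊆ q τ x) }

    -- Along a limit avoiding `B`, the first alternative leaves functional `e` without a value below
    -- `2 ^ x` at `x`; the second makes it equal to Φ_x(x) relative to `D`.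
    Met : ℕ → Condition → Set
    Met e c = (∃ λ x → ∀ τ i → i < 2 ^ x → DerEv τ e x i → B c τ)
            ⊎ (∃ λ x → ∃ λ i → Φ D x x i × Σ String λ τ → stem c ≽ τ × DerEv τ e x i)

    Met-mono : ∀ {e c' c} → c' ⊑ c → Met e c → Met e c'
    Met-mono p (inj₁ (x , avoid)) = inj₁ (x , λ τ i i<2^x d → B-⊆ p τ (avoid τ i i<2^x d))
    Met-mono p (inj₂ (x , i , φ , τ , ≽τ , d)) = inj₂ (x , i , φ , τ , ≽-trans (stem-≽ p) ≽τ , d)

    bigGoal : ℕ → ℕ → String → Vec (Tm Z 2) 7
    bigGoal e k σ = T.big (con k) (con (encS σ)) (con (length σ)) (con e & v1 & v0)

    bigGoal-sound : ∀ {e k σ x i} → Der (G.big k (encS σ) (length σ) (pr e (pr x i))) →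
      Big k (λ τ → DerEv τ e x i) σ
    bigGoal-sound {σ = σ} d = meaning ((λ _ ()) , (λ _ _ ()) , (λ _ _ _ ())) d σ refl refl _ _ _ refl
      where open Meaning Z (λ _ → ⊥)

    -- If bigness never fails, then Z computes a choice of values i < 2^x whose set of strings is big;
    -- as this choice is not DNC over D, it takes a value Φ_x^D(x).
    agreement : ∀ e k σ → (∀ x → ∃ λ i → i < 2 ^ x × Big k (λ τ → DerEv τ e x i) σ) →
      ∃ λ x → ∃ λ i → Φ D x x i × Big k (λ τ → DerEv τ e x i) σ
    agreement e k σ bigs with em {∃ λ x → ∃ λ i → Φ D x x i × Big k (λ τ → DerEv τ e x i) σ}
    ... | yes found = found
    ... | no ¬found = ⊥-elim (Z-not-HDNC (g , Fn→Computes gFn , dnc , bounded))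
      where
      f : ℕ → ℕ → ℕ
      -- The second summand vanishes exactly when the value found is below `2 ^ x`; the derivation
      -- search alone might return a larger one.
      f w x = search (bigGoal e k σ) w x + (suc (fst w) ∸ 2 ^ x)

      fFn : Fn₂ Z f
      fFn = Fn₂-cong (λ _ _ → refl) (fn (ap2 addFn (ap2 (searchFn (bigGoal e k σ)) v0 v1)
              (ap2 monusFn (sc (ap1 fstFn v0)) (ap1 pow2Fn v1))))

      total : ∀ x → ∃ λ w → f w x ≡ 0
      total x with bigs x
      ... | i , i<2^x , b with search-complete (bigGoal e k σ) i x (big-complete b)
      ...   | w , refl , eq = w , cong₂ _+_ eq (m≤n⇒m∸n≡0 i<2^x)

      found : Σ (Vec ℕ 1 → ℕ) λ h → Fn Z 1 h × (∀ xs → un2 f (h xs ∷ xs) ≡ 0)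
      found = muFn fFn λ { (x ∷ []) → total x }

      g : ℕ → ℕ
      g x = fst (proj₁ found (x ∷ []))

      gFn : Fn₁ Z g
      gFn = Fn₁-cong (λ _ → refl) (fn (ap1 fstFn (app (proj₁ found) (proj₁ (proj₂ found)) (v0 ∷ []))))

      bounded : ∀ x → g x < 2 ^ x
      bounded x = m∸n≡0⇒m≤n (m+n≡0⇒n≡0 (search (bigGoal e k σ) (proj₁ found (x ∷ [])) x)
                    (proj₂ (proj₂ found) (x ∷ [])))

      dnc : IsDNC D g
      dnc x y φ refl = ¬found (x , y , φ , bigGoal-sound (search-sound (bigGoal e k σ) (proj₁ found (x ∷ [])) x
        (m+n≡0⇒m≡0 (search (bigGoal e k σ) (proj₁ found (x ∷ [])) x) (proj₂ (proj₂ found) (x ∷ [])))))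

    meet : ∀ e c → Σ Condition λ c' → c' ⊑ c × Met e c'
    meet e c@(condition σ k B small)
      -- The size leaves `k` for `B` and `k` for each of the `2 ^ x` values: if the enlarged set is
      -- big and `B` is small, one value is forced on a `k`-big set.
      with em {∃ λ x → ¬ Big (k + unionSize k (2 ^ x)) (λ τ → B τ ⊎ (∃ λ i → i < 2 ^ x × DerEv τ e x i)) σ}
    ... | yes (x , small') = condition σ _ _ small' , record { stem-≽ = done ; B-⊆ = λ τ → inj₁ }
                           , inj₁ (x , λ τ i i<2^x d → inj₂ (i , i<2^x , d))
    ... | no ¬small with agreement e k σ bigs
      where
      bigs : ∀ x → ∃ λ i → i < 2 ^ x × Big k (λ τ → DerEv τ e x i) σ
      bigs x with em {Big (k + unionSize k (2 ^ x)) (λ τ → B τ ⊎ (∃ λ i → i < 2 ^ x × DerEv τ e x i)) σ}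
      ... | no ¬b = ⊥-elim (¬small (x , ¬b))
      ... | yes b with Big-∪ {k} b
      ...   | inj₁ b' = ⊥-elim (small b')
      ...   | inj₂ b' = Big-⋃ (λ i τ → DerEv τ e x i) (2 ^ x) b'
    ...   | x , i , φ , b with escape b small
    ...     | τ , τ≽σ , d , small' = condition τ k B small' , record { stem-≽ = τ≽σ ; B-⊆ = λ _ p → p }
                                   , inj₂ (x , i , φ , τ , done , d)

    -- `meet` may leave the stem unchanged; one further letter makes it grow, so that the limit is
    -- total.
    next : ∀ e c → Σ Condition λ c' → c' ⊑ c × length (stem c) < length (stem c') × Met e c'
    next e c with meet e c
    ... | c₁ , p , met with small-child (small c₁)
    ...   | n , small' = c' , ⊑-trans q p , s≤s (≽-length (stem-≽ p)) , Met-mono q met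
      where
      c' : Condition
      c' = condition (n ∷ stem c₁) (k c₁) (B c₁) small'

      q : c' ⊑ c₁
      q = record { stem-≽ = more done ; B-⊆ = λ _ b → b }

    opaque
      conds : ℕ → Condition
      -- Size 2 comes from `Agrees-2-small`; the empty string agrees nowhere, having no letters.
      conds zero    = condition [] 2 Agrees λ b → case-[] (Agrees-2-small b)
        where
        case-[] : ¬ Agrees []
        case-[] (_ , _ , () , _)
      conds (suc e) = proj₁ (next e (conds e))

      conds-Agrees : ∀ τ → Agrees τ → B (conds 0) τ
      conds-Agrees τ a = a

      conds-next : ∀ e → conds (suc e) ⊑ conds e × length (stem (conds e)) < length (stem (conds (suc e)))
                         × Met e (conds (suc e))
      conds-next e = proj₂ (next e (conds e))

    open Limit (λ e → stem (conds e)) (λ e → stem-≽ (proj₁ (conds-next e))) (λ e → proj₁ (proj₂ (conds-next e))) public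

    B-mono : ∀ {s t} → s ≤ t → ∀ τ → B (conds s) τ → B (conds t) τ
    B-mono {s} {t} s≤t τ p = subst (λ t → B (conds t) τ) (m∸n+n≡m s≤t) (go (t ∸ s))
      where
      go : ∀ d → B (conds (d + s)) τ
      go zero    = p
      go (suc d) = B-⊆ (proj₁ (conds-next (d + s))) τ (go d)

    -- A stem lying in `B` would be a one-leaf tree, big for every size. Later sets `B` contain the
    -- earlier ones, so no later stem lies in them either.
    avoids : ∀ s → ¬ Eventually (λ t → B (conds s) (stem (conds t)))
    avoids s (t , q) = small (conds (s ⊔ t))
      (leaf (B-mono (m≤m⊔n s t) _ (q (s ⊔ t) (m≤n⊔m s t))))

    limit-DNC : IsDNC D limit
    limit-DNC e y φ refl = avoids 0
      (eventually-map (λ t at → conds-Agrees _ (e , limit e , at , φ)) (limit-eventually e))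

    limit-not-HDNC : ¬ HDNC pow2 D (Z ⊕ graph limit)
    limit-not-HDNC (g , (e , computes) , dnc , bounded) with proj₂ (proj₂ (conds-next e))
    ... | inj₁ (x , avoid) = avoids (suc e)
      (eventually-map (λ t d → avoid _ (g x) (bounded x) d) (DerEv-complete Z (computes x)))
    ... | inj₂ (x , i , φ , τ , ≽τ , d) = dnc x i φ
      (Φ-functional (computes x) (DerEv-sound Z (prefix-≽ ≽τ (sig-prefix (suc e))) d))

  bushy-forcing : ∀ D Z → ¬ HDNC pow2 D Z → Σ SetN λ A → DNC D A × ¬ HDNC pow2 D (Z ⊕ A)
  bushy-forcing D Z h = graph limit , (limit , Fn→Computes (graphFn limit) , limit-DNC) , limit-not-HDNC
    where open Forcing D Z h

theorem5p13 : ExcludedMiddle 0ℓ →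
    (m : ℕ) (D Z : SetN) →
    ¬ HDNC pow2 (jumpⁿ m D) (jumpⁿ m Z) →
    Σ SetN λ G → DNC (jumpⁿ m D) (jumpⁿ m G) × ¬ HDNC pow2 (jumpⁿ m D) (jumpⁿ m (Z ⊕ G))
theorem5p13 em m D Z Z-not-HDNC =
  let open Classical em
      A , (f , A-computes , f-DNC) , Z⊕A-not-HDNC = bushy-forcing (jumpⁿ m D) (jumpⁿ m Z) Z-not-HDNC
      G , Z≤G , Gᵐ≤Zᵐ⊕A , A≤Gᵐ = jumpⁿ-inversion m Z A
      -- Because `Z ≤T G`, the join `Z ⊕ G` lies below `G`, and so do their jumps.
      [Z⊕G]ᵐ≤Zᵐ⊕A = ≤T-trans (jumpⁿ-mono m (⊕-lub Z≤G ≤T-refl)) Gᵐ≤Zᵐ⊕A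
  in G
   , (f , Fn→Computes (Fn-mono A≤Gᵐ (Computes→Fn A-computes)) , f-DNC)
   , λ (g , computes , hdnc) → Z⊕A-not-HDNC (g , Fn→Computes (Fn-mono [Z⊕G]ᵐ≤Zᵐ⊕A (Computes→Fn computes)) , hdnc)
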